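{- For $k\in\mathbb{N}$, let $SP(k)$ denote the minimum of $\max\{|A+A|,|AA|\}$ over all sets $A\subseteq\mathbb{N}$ with $|A|=k$. Then $$SP(k)=\begin{cases}3k-3, & 2\le k\le 7,\\ 3k-2, & k=8,9.\end{cases}$$
   Context: For $A\subseteq\mathbb{R}$, $A+A=\{a+b: a,b\in A\}$ and $AA=\{ab: a,b\in A\}$. $\mathbb{N}$ denotes the positive integers, and $|X|$ is the number of elements of a finite set $X$. -}

module Defs where

open import Data.Nat using (ℕ; _+_; _*_; _≤_; _<_; _⊔_)
open import Data.Nat.Properties using (_≟_)
open import Data.List using (List; length; deduplicate; cartesianProductWith)
open import Data.List.Relation.Unary.All using (All)
open import Data.List.Relation.Unary.Unique.Propositional using (Unique)
open import Data.Product using (Σ; _×_)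
open import Relation.Binary.PropositionalEquality using (_≡_)

-- A finite set A ⊆ ℕ (positive integers) is represented by a duplicate-free
-- list of naturals all ≥ 1; its cardinality is the list length.
IsPosSet : List ℕ → Set
IsPosSet A = Unique A × All (λ a → 1 ≤ a) A

card : List ℕ → ℕ
card X = length (deduplicate _≟_ X)

sumList : List ℕ → List ℕ
sumList A = cartesianProductWith _+_ A A

prodList : List ℕ → List ℕ
prodList A = cartesianProductWith _*_ A A

spCost : List ℕ → ℕ
spCost A = card (sumList A) ⊔ card (prodList A)

SPis : ℕ → ℕ → Set
SPis k m =
  Σ (List ℕ) (λ A → IsPosSet A × length A ≡ k × spCost A ≡ m)
  × ((A : List ℕ) → IsPosSet A → length A ≡ k → m ≤ spCost A)

{-# OPTIONS --safe #-}
module Submission where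

-- Order A by size.  Multiplying the largest element v and the second largest u by elements of A
-- gives the new products v v and v u; if no third product v w is new, every element of A is v times
-- a power of u / v.  Hence either A lies on a multiplicative line (log x is an affine function of
-- some p-adic valuation), or |AA| ≥ 3k - 3.  On a line all sums of two elements are distinct, as one
-- sees from a term of least valuation, so |A + A| = k (k + 1) / 2 ≥ 3k - 3.
--
-- If |AA| = 3k - 3 off a line, A is built by successively adding quotients y z / x of its smaller
-- elements.  Written in the exponents of three independent elements this is a finite search; for
-- k = 8, 9 it leaves only unions of two geometric progressions with a common ratio p / q.  A
-- coincidence of two of their sums determines the relative position of the progressions, and then
-- the number of sums can be computed: for p ≤ 8 numerically, and for p ≥ 9 as for (p , q) = (9 , 1),
-- because the coefficients of the monomials p ^ e q ^ f involved are too small for a carry.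

open import Defs
open import Data.Nat
open import Data.Nat.Properties
open import Data.Nat.Divisibility
open import Data.Nat.Primality using (Prime; euclidsLemma; prime⇒nonTrivial)
open import Data.Nat.Primality.Factorisation using (factorise)
open import Data.Nat.Coprimality using (Coprime; coprime-divisor; coprime-/gcd)
open import Data.Nat.GCD using (gcd; gcd[m,n]∣m; gcd[m,n]∣n; gcd[m,n]≡0⇒m≡0)
open import Data.Nat.DivMod using (m*[n/m]≡n)
open import Data.Nat.Induction using (<-rec)
open import Data.Nat.ListAction using (product)
open import Data.Nat.Solver using (module +-*-Solver)
open import Data.Bool using (Bool; true; false; T; if_then_else_; _∧_; _∨_; not)
open import Data.Bool.ListAction using (any; all)
open import Data.Bool.Properties using (T-∧; T-∨; T-≡)
open import Data.Fin using (Fin; toℕ) renaming (zero to 0F; suc to sucF)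
open import Data.Fin.Properties using (all?)
open import Data.List hiding (any; all; product; sum; find)
open import Data.List.Properties using (length-++; length-map; length-++-sucʳ; ∷-injectiveˡ; ∷-injectiveʳ; map-∘)
open import Data.List.Membership.Propositional using (_∈_; _∉_; find; lose)
open import Data.List.Membership.Propositional.Properties
open import Data.List.Membership.DecPropositional _≟_ using (_∈?_)
open import Data.List.Relation.Unary.All as All using (All; []; _∷_)
open import Data.List.Relation.Unary.All.Properties using (all⁺; ¬All⇒Any¬)
open import Data.List.Relation.Unary.Any as Any using (Any; here; there)
open import Data.List.Relation.Unary.Any.Properties using (any⁺; any⁻)
open import Data.List.Relation.Unary.AllPairs as AllPairs using (AllPairs; []; _∷_)
import Data.List.Relation.Unary.AllPairs.Properties as AllPairsₚ
open import Data.List.Relation.Unary.Linked.Properties using (Linked⇒AllPairs)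
open import Data.List.Relation.Unary.Unique.Propositional using (Unique)
import Data.List.Relation.Unary.Unique.Propositional.Properties as Unique
open import Data.List.Relation.Unary.Unique.DecPropositional _≟_ using (unique?)
open import Data.List.Relation.Unary.Unique.DecPropositional.Properties _≟_ using (deduplicate-!)
open import Data.List.Relation.Binary.Subset.Propositional using (_⊆_)
open import Data.List.Relation.Binary.Permutation.Propositional using (_↭_; ↭-sym; ↭⇒↭ₛ)
open import Data.List.Relation.Binary.Permutation.Propositional.Properties using (∈-resp-↭; All-resp-↭; ↭-length)
open import Data.Product using (Σ; ∃; ∃₂; _×_; _,_; proj₁; proj₂)
open import Data.Sum using (_⊎_; inj₁; inj₂; [_,_]′)
open import Data.Unit using (⊤; tt)
open import Function using (_∘_; id)
open import Function.Bundles using (Equivalence)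
open import Relation.Binary using (tri<; tri≈; tri>)
open import Relation.Binary.PropositionalEquality
open import Relation.Nullary
open import Relation.Nullary.Decidable using (from-yes; _×-dec_; _→-dec_; True; toWitness)
import Data.List.Relation.Binary.Permutation.Setoid.Properties (setoid ℕ) as PermutationSetoid
import Relation.Binary.Construct.Flip.EqAndOrd as Flip
open import Data.List.Sort (Flip.decTotalOrder ≤-decTotalOrder) using (sort; sort-↭; sort-↗)

-- Cardinalities

-- The count leaves no slack. Let `n` elements of `A` precede, in increasing order, the first
-- element `γ` off the line through the two smallest ones. These have at least `2 n - 1` products,
-- with equality only for a geometric progression; `γ` adds `n + 1` new products and every later
-- element at least three. With exactly `3 k - 3` products the initial part is therefore a geometric
-- progression and each later element makes exactly three new products. A later `v` none of whose
-- products `v x` is old would make at least four, so `v` is a quotient of smaller elements. This is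
-- why `a₀`, `a₁` and `γ` generate everything. The proof stays in ℕ: collinearity is an equality of
-- two monomials, obtained from a determinant by moving its negative terms across; exponent vectors
-- carry a common shift; an element meets its monomial after multiplication by a common denominator.
-- The threshold `p ≥ 9` comes from the sums: once a coincidence fixes the ratio of the two
-- progressions, comparing two further sums puts at most eight monomials on either side.

desc⇒unique : ∀ {A} → AllPairs _>_ A → Unique A
desc⇒unique [] = []
desc⇒unique (p ∷ ps) = All.map >⇒≢ p ∷ desc⇒unique ps

length-⊆ : {A : Set} {xs ys : List A} → Unique xs → xs ⊆ ys → length xs ≤ length ys
length-⊆ {xs = []} _ _ = z≤n
length-⊆ {xs = x ∷ xs} (x∉ ∷ u) sub with ∈-∃++ (sub (here refl))
... | l , r , refl =
  subst (suc (length xs) ≤_) (sym (length-++-sucʳ l x r)) (s≤s (length-⊆ u rest))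
  where
  rest : xs ⊆ l ++ r
  rest y∈ with ∈-++⁻ l (sub (there y∈))
  ... | inj₁ y∈l = ∈-++⁺ˡ y∈l
  ... | inj₂ (here refl) = contradiction refl (All.lookup x∉ y∈)
  ... | inj₂ (there y∈r) = ∈-++⁺ʳ l y∈r

length≤card : ∀ {xs X} → Unique xs → xs ⊆ X → length xs ≤ card X
length≤card u sub = length-⊆ u (∈-deduplicate⁺ _≟_ ∘ sub)

card-mono : ∀ {X Y} → X ⊆ Y → card X ≤ card Y
card-mono {X} sub = length≤card (deduplicate-! X) (sub ∘ ∈-deduplicate⁻ _≟_ X)

card-disjoint : ∀ {X Y N} → Unique N → N ⊆ Y → X ⊆ Y → (∀ {x} → x ∈ N → x ∉ X) →
                card X + length N ≤ card Y
card-disjoint {X} {Y} {N} u N⊆Y X⊆Y new =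
  subst (_≤ card Y) (length-++ (deduplicate _≟_ X))
    (length≤card (Unique.++⁺ (deduplicate-! X) u
                    (λ (x∈X , x∈N) → new x∈N (∈-deduplicate⁻ _≟_ X x∈X)))
                 λ x∈ → [ X⊆Y ∘ ∈-deduplicate⁻ _≟_ X , N⊆Y ]′ (∈-++⁻ (deduplicate _≟_ X) x∈))

module Growth (_⊙_ : ℕ → ℕ → ℕ) where

  square : List ℕ → List ℕ
  square A = cartesianProductWith _⊙_ A A

  ∈-square⁺ : ∀ {A x y} → x ∈ A → y ∈ A → x ⊙ y ∈ square A
  ∈-square⁺ = ∈-cartesianProductWith⁺ _⊙_

  ∈-square⁻ : ∀ A {z} → z ∈ square A → ∃₂ λ x y → x ∈ A × y ∈ A × z ≡ x ⊙ y
  ∈-square⁻ A = ∈-cartesianProductWith⁻ _⊙_ A A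

  square-⊆ : ∀ {A B} → A ⊆ B → square A ⊆ square B
  square-⊆ {A} sub z∈ with ∈-square⁻ A z∈
  ... | _ , _ , x∈ , y∈ , refl = ∈-square⁺ (sub x∈) (sub y∈)

  -- Cancellation keeps the values `v ⊙ x` apart, so only their absence from the old square has to
  -- be shown. The operation is left open because the count serves sums on a line as well as
  -- products.
  growth : ∀ {v A xs} → (∀ {x y} → v ⊙ x ≡ v ⊙ y → x ≡ y) → Unique xs → xs ⊆ v ∷ A →
           (∀ {x} → x ∈ xs → v ⊙ x ∉ square A) →
           card (square A) + length xs ≤ card (square (v ∷ A))
  growth {v} {A} {xs} inj u xs⊆ new =
    subst (λ n → card (square A) + n ≤ _) (length-map (v ⊙_) xs)
      (card-disjoint (Unique.map⁺ inj u) image⊆ (square-⊆ {A} {v ∷ A} there) fresh)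
    where
    image⊆ : map (v ⊙_) xs ⊆ square (v ∷ A)
    image⊆ z∈ with ∈-map⁻ (v ⊙_) z∈
    ... | _ , x∈ , refl = ∈-square⁺ (here refl) (xs⊆ x∈)

    fresh : ∀ {z} → z ∈ map (v ⊙_) xs → z ∉ square A
    fresh z∈ with ∈-map⁻ (v ⊙_) z∈
    ... | _ , x∈ , refl = new x∈

-- Cancellation and powers

*-cancelˡ : ∀ {o m n} → 1 ≤ o → o * m ≡ o * n → m ≡ n
*-cancelˡ {o} {m} {n} o≥1 = *-cancelˡ-≡ m n o {{>-nonZero o≥1}}

^-pos : ∀ {a} n → 1 ≤ a → 1 ≤ a ^ n
^-pos {a} n a≥1 = m^n>0 a {{>-nonZero a≥1}} n

*-pos : ∀ {a b} → 1 ≤ a → 1 ≤ b → 1 ≤ a * b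
*-pos = *-mono-≤

^-distribʳ-* : ∀ a b n → (a * b) ^ n ≡ a ^ n * b ^ n
^-distribʳ-* a b zero = refl
^-distribʳ-* a b (suc n) rewrite ^-distribʳ-* a b n =
  solve 4 (λ a b c d → a :* b :* (c :* d) := a :* c :* (b :* d)) refl a b (a ^ n) (b ^ n)
  where
  open +-*-Solver

^-injectiveˡ : ∀ {a b} d → 1 ≤ d → a ^ d ≡ b ^ d → a ≡ b
^-injectiveˡ {a} {b} d d≥1 eq with <-cmp a b
... | tri< a<b _ _ = contradiction eq (<⇒≢ (^-monoˡ-< d {{>-nonZero d≥1}} a<b))
... | tri≈ _ a≡b _ = a≡b
... | tri> _ _ b<a = contradiction (sym eq) (<⇒≢ (^-monoˡ-< d {{>-nonZero d≥1}} b<a))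

^-cross< : ∀ {a b i j} → 1 ≤ a → 1 ≤ b → i < j → a ^ i * b ^ j ≡ a ^ j * b ^ i → a ≡ b
^-cross< {a} {b} {i} {j} a≥1 b≥1 i<j eq with m≤n⇒∃[o]m+o≡n i<j
... | d , refl = sym (^-injectiveˡ (suc d) (s≤s z≤n)
  (*-cancelˡ (*-pos (^-pos i a≥1) (^-pos i b≥1)) (begin
    a ^ i * b ^ i * b ^ suc d    ≡⟨ *-assoc (a ^ i) (b ^ i) _ ⟩
    a ^ i * (b ^ i * b ^ suc d)  ≡⟨ cong (a ^ i *_) (^-distribˡ-+-* b i (suc d)) ⟨
    a ^ i * b ^ (i + suc d)      ≡⟨ cong (λ k → a ^ i * b ^ k) (+-suc i d) ⟩
    a ^ i * b ^ suc (i + d)      ≡⟨ eq ⟩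
    a ^ suc (i + d) * b ^ i      ≡⟨ cong (λ k → a ^ k * b ^ i) (+-suc i d) ⟨
    a ^ (i + suc d) * b ^ i      ≡⟨ cong (_* b ^ i) (^-distribˡ-+-* a i (suc d)) ⟩
    a ^ i * a ^ suc d * b ^ i    ≡⟨ solve 3 (λ x y z → x :* y :* z := x :* z :* y) refl (a ^ i) (a ^ suc d) (b ^ i) ⟩
    a ^ i * b ^ i * a ^ suc d    ∎)))
  where
  open ≡-Reasoning
  open +-*-Solver

-- This is `(a / b) ^ (i - j) = 1` without division; it serves to compare powers of ratios.
^-cross : ∀ {a b i j} → 1 ≤ a → 1 ≤ b → i ≢ j → a ^ i * b ^ j ≡ a ^ j * b ^ i → a ≡ b
^-cross {i = i} {j} a≥1 b≥1 i≢j eq with <-cmp i j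
... | tri< i<j _ _ = ^-cross< a≥1 b≥1 i<j eq
... | tri≈ _ i≡j _ = contradiction i≡j i≢j
... | tri> _ _ j<i = ^-cross< a≥1 b≥1 j<i (sym eq)

-- Valuations

module Valuation {ℓ : ℕ} (ℓ-prime : Prime ℓ) where

  ℓ≥2 : 2 ≤ ℓ
  ℓ≥2 = nonTrivial⇒n>1 ℓ {{prime⇒nonTrivial ℓ-prime}}

  ℓ≥1 : 1 ≤ ℓ
  ℓ≥1 = <⇒≤ ℓ≥2

  Split : ℕ → ℕ → Set
  Split x e = ∃ λ u → x ≡ ℓ ^ e * u × ¬ ℓ ∣ u

  split : ∀ x → 1 ≤ x → ∃ (Split x)
  split = <-rec (λ x → 1 ≤ x → ∃ (Split x)) step
    where
    step : ∀ x → (∀ {y} → y < x → 1 ≤ y → ∃ (Split y)) → 1 ≤ x → ∃ (Split x)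
    step x rec x≥1 with ℓ ∣? x
    ... | no ∤ = 0 , x , sym (+-identityʳ x) , ∤
    ... | yes (divides zero refl) = contradiction x≥1 λ ()
    ... | yes (divides y@(suc _) refl) with rec (m<m*n y ℓ ℓ≥2) (s≤s z≤n)
    ...   | e , u , y≡ , ∤u = suc e , u , trans (*-comm y ℓ) (trans (cong (ℓ *_) y≡) (sym (*-assoc ℓ (ℓ ^ e) u))) , ∤u

  v : ℕ → ℕ
  -- A default value; the laws of `v` are stated for positive arguments.
  v zero = 0
  v x@(suc _) = proj₁ (split x (s≤s z≤n))

  v-split : ∀ {x} → 1 ≤ x → Split x (v x)
  v-split {suc _} _ = proj₂ (split _ (s≤s z≤n))

  ^∣⇒≤ : ∀ {x e k} → Split x e → ℓ ^ k ∣ x → k ≤ e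
  ^∣⇒≤ {e = e} {k} (u , refl , ∤u) k∣ with k ≤? e
  ... | yes k≤e = k≤e
  ... | no k≰e with m≤n⇒∃[o]m+o≡n (≰⇒> k≰e)
  ...   | d , refl = contradiction (∣-trans (m∣m*n (ℓ ^ d))
      (*-cancelˡ-∣ (ℓ ^ e) {{>-nonZero (^-pos e ℓ≥1)}} (subst (_∣ ℓ ^ e * u) eq k∣))) ∤u
    where
    eq : ℓ ^ suc (e + d) ≡ ℓ ^ e * (ℓ * ℓ ^ d)
    eq = trans (cong (ℓ ^_) (sym (+-suc e d))) (^-distribˡ-+-* ℓ e (suc d))

  v-∣ : ∀ {x} → 1 ≤ x → ℓ ^ v x ∣ x
  v-∣ {x} x≥1 with v-split x≥1
  ... | u , eq , _ = divides u (trans eq (*-comm (ℓ ^ v x) u))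

  v-max : ∀ {x k} → 1 ≤ x → ℓ ^ k ∣ x → k ≤ v x
  v-max x≥1 = ^∣⇒≤ (v-split x≥1)

  v-unique : ∀ {x e} → 1 ≤ x → Split x e → v x ≡ e
  v-unique {e = e} x≥1 s@(u , eq , _) =
    ≤-antisym (^∣⇒≤ s (v-∣ x≥1)) (v-max x≥1 (divides u (trans eq (*-comm (ℓ ^ e) u))))

  v-* : ∀ {x y} → 1 ≤ x → 1 ≤ y → v (x * y) ≡ v x + v y
  v-* {x} {y} x≥1 y≥1 with v-split x≥1 | v-split y≥1
  ... | a , x≡ , ∤a | b , y≡ , ∤b = v-unique (*-pos x≥1 y≥1) (a * b , eq , ∤ab)
    where
    open +-*-Solver
    eq : x * y ≡ ℓ ^ (v x + v y) * (a * b)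
    eq = trans (cong₂ _*_ x≡ y≡) (trans
      (solve 4 (λ p a q b → p :* a :* (q :* b) := p :* q :* (a :* b)) refl (ℓ ^ v x) a (ℓ ^ v y) b)
      (cong (_* (a * b)) (sym (^-distribˡ-+-* ℓ (v x) (v y)))))
    ∤ab : ¬ ℓ ∣ a * b
    ∤ab ab with euclidsLemma a b ℓ-prime ab
    ... | inj₁ ∣a = ∤a ∣a
    ... | inj₂ ∣b = ∤b ∣b

prime-divisor : ∀ n → 2 ≤ n → ∃ λ ℓ → Prime ℓ × ℓ ∣ n
prime-divisor n@(suc (suc _)) _ with factorise n
... | record { factors = [] ; isFactorisation = () }
... | record { factors = ℓ ∷ ps ; isFactorisation = eq ; factorsPrime = pr ∷ _ } =
  ℓ , pr , divides (product ps) (trans eq (*-comm ℓ (product ps)))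
prime-divisor (suc zero) (s≤s ())

lowest-terms : ∀ {a b} → 1 ≤ a → 1 ≤ b →
               ∃ λ g → ∃₂ λ s t → 1 ≤ g × a ≡ g * s × b ≡ g * t × Coprime s t
lowest-terms {a} {b} a≥1 b≥1 =
  gcd a b , _ , _ , >-nonZero⁻¹ (gcd a b) {{nz}} ,
  sym (m*[n/m]≡n {gcd a b} {{nz}} (gcd[m,n]∣m a b)) , sym (m*[n/m]≡n {gcd a b} {{nz}} (gcd[m,n]∣n a b)) ,
  coprime-/gcd a b {{nz}}
  where
  nz : NonZero (gcd a b)
  nz = ≢-nonZero λ g≡0 → <⇒≢ a≥1 (sym (gcd[m,n]≡0⇒m≡0 {a} {b} g≡0))

-- In lowest terms `a / b = s / t` with `s < t`, so `t > 1`. A prime divisor of `t` does not divide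
-- `s`, hence tells `a` from `b`.
separating-prime : ∀ {a b} → 1 ≤ a → a < b →
                   ∃ λ ℓ → Σ (Prime ℓ) λ pr → Valuation.v pr a ≢ Valuation.v pr b
separating-prime {a} {b} a≥1 a<b with lowest-terms a≥1 (≤-trans a≥1 (<⇒≤ a<b))
... | g , s , t , g≥1 , refl , refl , cop = ℓ , pr , diff
  where
  s≥1 : 1 ≤ s
  s≥1 = n≢0⇒n>0 λ { refl → <⇒≢ a≥1 (sym (*-zeroʳ g)) }
  s<t : s < t
  s<t = *-cancelˡ-< g s t a<b
  ℓ : ℕ
  ℓ = proj₁ (prime-divisor t (≤-trans (s≤s s≥1) s<t))
  pr : Prime ℓ
  pr = proj₁ (proj₂ (prime-divisor t (≤-trans (s≤s s≥1) s<t)))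
  ℓ∣t : ℓ ∣ t
  ℓ∣t = proj₂ (proj₂ (prime-divisor t (≤-trans (s≤s s≥1) s<t)))
  open Valuation pr
  t≥1 : 1 ≤ t
  t≥1 = ≤-trans s≥1 (<⇒≤ s<t)
  diff : v (g * s) ≢ v (g * t)
  diff eq = contradiction (cop (ℓ∣s , ℓ∣t)) (λ ℓ≡1 → <⇒≢ ℓ≥2 (sym ℓ≡1))
    where
    vs≡vt : v s ≡ v t
    vs≡vt = +-cancelˡ-≡ (v g) _ _ (trans (sym (v-* g≥1 s≥1)) (trans eq (v-* g≥1 t≥1)))
    vs≥1 : 1 ≤ v s
    vs≥1 = subst (1 ≤_) (sym vs≡vt) (v-max t≥1 (subst (_∣ t) (sym (^-identityʳ ℓ)) ℓ∣t))
    ℓ∣s : ℓ ∣ s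
    ℓ∣s = ∣-trans (subst (_∣ ℓ ^ v s) (^-identityʳ ℓ) (pow∣ vs≥1)) (v-∣ s≥1)
      where
      pow∣ : ∀ {k} → 1 ≤ k → ℓ ^ 1 ∣ ℓ ^ k
      pow∣ {suc k} _ = subst (_∣ ℓ * ℓ ^ k) (sym (^-identityʳ ℓ)) (m∣m*n (ℓ ^ k))

-- Multiplicative lines

module Line (f : ℕ → ℕ) (f-* : ∀ {x y} → 1 ≤ x → 1 ≤ y → f (x * y) ≡ f x + f y)
            {a₀ a₁ : ℕ} (a₀≥1 : 1 ≤ a₀) (a₀<a₁ : a₀ < a₁) (f-sep : f a₀ ≢ f a₁) where

  open +-*-Solver
  open ≡-Reasoning

  a₁≥1 : 1 ≤ a₁
  a₁≥1 = ≤-trans a₀≥1 (<⇒≤ a₀<a₁)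

  f-1 : f 1 ≡ 0
  f-1 = +-cancelˡ-≡ (f 1) _ _ (trans (sym (f-* ≤-refl ≤-refl)) (sym (+-identityʳ (f 1))))

  -- The logarithm of `W n x` is `m log x + f x log a + n log c`. The index `n` is the number of
  -- factors that make up `x`: the constant enters once per factor, which makes the affine form
  -- multiplicative.
  module Weight (m a c : ℕ) where

    W : ℕ → ℕ → ℕ
    W n x = x ^ m * a ^ f x * c ^ n

    w : ℕ → ℕ
    w = W 1

    W-* : ∀ n k {x y} → 1 ≤ x → 1 ≤ y → W (n + k) (x * y) ≡ W n x * W k y
    W-* n k {x} {y} x≥1 y≥1 rewrite f-* x≥1 y≥1 | ^-distribʳ-* x y m
      | ^-distribˡ-+-* a (f x) (f y) | ^-distribˡ-+-* c n k =
      solve 6 (λ p q r s t u → p :* q :* (r :* s) :* (t :* u) := p :* r :* t :* (q :* s :* u)) refl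
        (x ^ m) (y ^ m) (a ^ f x) (a ^ f y) (c ^ n) (c ^ k)

    W-^ : ∀ n {x} → 1 ≤ x → W n (x ^ n) ≡ w x ^ n
    W-^ zero _ rewrite f-1 | ^-zeroˡ m = refl
    W-^ (suc n) {x} x≥1 = trans (W-* 1 n x≥1 (^-pos n x≥1)) (cong (w x *_) (W-^ n x≥1))

    w-affine : ∀ {x y z t} → 1 ≤ x → 1 ≤ y → 1 ≤ z → 1 ≤ t → x * y ≡ z * t → w x * w y ≡ w z * w t
    w-affine x≥1 y≥1 z≥1 t≥1 eq =
      trans (sym (W-* 1 1 x≥1 y≥1)) (trans (cong (W 2) eq) (W-* 1 1 z≥1 t≥1))

    w-pos : ∀ {x} → 1 ≤ a → 1 ≤ c → 1 ≤ x → 1 ≤ w x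
    w-pos {x} a≥1 c≥1 x≥1 = *-pos (*-pos (^-pos m x≥1) (^-pos (f x) a≥1)) (^-pos 1 c≥1)

  module L = Weight (f a₁) a₀ (a₁ ^ f a₀)
  module R = Weight (f a₀) a₁ (a₀ ^ f a₁)

  -- In logarithmic terms: the points (f x , log x), (f a₀ , log a₀), (f a₁ , log a₁) are collinear.
  On : ℕ → Set
  On x = L.w x ≡ R.w x

  on? : ∀ x → Dec (On x)
  on? x = L.w x ≟ R.w x

  L-pos : ∀ {x} → 1 ≤ x → 1 ≤ L.w x
  L-pos = L.w-pos a₀≥1 (^-pos (f a₀) a₁≥1)

  R-pos : ∀ {x} → 1 ≤ x → 1 ≤ R.w x
  R-pos = R.w-pos a₁≥1 (^-pos (f a₁) a₀≥1)

  on-a₀ : On a₀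
  on-a₀ = solve 3 (λ p q r → p :* q :* (r :* con 1) := q :* r :* (p :* con 1)) refl
            (a₀ ^ f a₁) (a₀ ^ f a₀) (a₁ ^ f a₀)

  on-a₁ : On a₁
  on-a₁ = solve 3 (λ p q r → p :* q :* (r :* con 1) := r :* p :* (q :* con 1)) refl
            (a₁ ^ f a₁) (a₀ ^ f a₁) (a₁ ^ f a₀)

  -- Both weights turn `v x = y z` into the same relation between weights, so agreement at three of
  -- the terms forces it at the fourth.
  on-fourth : ∀ {v x y z} → 1 ≤ v → 1 ≤ x → 1 ≤ y → 1 ≤ z → On x → On y → On z →
              v * x ≡ y * z → On v
  on-fourth {v} {x} {y} {z} v≥1 x≥1 y≥1 z≥1 ox oy oz eq = *-cancelˡ (L-pos x≥1) (begin
    L.w x * L.w v  ≡⟨ *-comm (L.w x) (L.w v) ⟩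
    L.w v * L.w x  ≡⟨ L.w-affine v≥1 x≥1 y≥1 z≥1 eq ⟩
    L.w y * L.w z  ≡⟨ cong₂ _*_ oy oz ⟩
    R.w y * R.w z  ≡⟨ R.w-affine v≥1 x≥1 y≥1 z≥1 eq ⟨
    R.w v * R.w x  ≡⟨ *-comm (R.w v) (R.w x) ⟩
    R.w x * R.w v  ≡⟨ cong (_* R.w v) ox ⟨
    L.w x * R.w v  ∎)

  -- x = v (u / v) ^ e
  Chain : ℕ → ℕ → ℕ → Set
  Chain v u x = ∃ λ e → x * v ^ e ≡ v * u ^ e

  -- The exponents add: `y z / v = v (u / v) ^ (e + e')`.
  chain-fourth : ∀ {v u x y z} → 1 ≤ v → v * x ≡ y * z → Chain v u y → Chain v u z → Chain v u x
  chain-fourth {v} {u} {x} {y} {z} v≥1 eq (e , p) (e' , q) = e + e' , *-cancelˡ v≥1 (begin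
    v * (x * v ^ (e + e'))          ≡⟨ cong (λ k → v * (x * k)) (^-distribˡ-+-* v e e') ⟩
    v * (x * (v ^ e * v ^ e'))      ≡⟨ *-assoc v x _ ⟨
    v * x * (v ^ e * v ^ e')        ≡⟨ cong (_* (v ^ e * v ^ e')) eq ⟩
    y * z * (v ^ e * v ^ e')        ≡⟨ rearrange y z (v ^ e) (v ^ e') ⟩
    y * v ^ e * (z * v ^ e')        ≡⟨ cong₂ _*_ p q ⟩
    v * u ^ e * (v * u ^ e')        ≡⟨ solve 3 (λ v p q → v :* p :* (v :* q) := v :* (v :* (p :* q))) refl v (u ^ e) (u ^ e') ⟩
    v * (v * (u ^ e * u ^ e'))      ≡⟨ cong (λ k → v * (v * k)) (^-distribˡ-+-* u e e') ⟨
    v * (v * u ^ (e + e'))          ∎)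
    where
    rearrange : ∀ a b c d → a * b * (c * d) ≡ a * c * (b * d)
    rearrange = solve 4 (λ a b c d → a :* b :* (c :* d) := a :* c :* (b :* d)) refl

  module _ {v u : ℕ} (v≥1 : 1 ≤ v) (u≥1 : 1 ≤ u) where

    chain-ratio : ∀ {x} e → 1 ≤ x → x * v ^ e ≡ v * u ^ e →
                  L.w x * L.w v ^ e ≡ L.w v * L.w u ^ e × R.w x * R.w v ^ e ≡ R.w v * R.w u ^ e
    chain-ratio {x} e x≥1 eq = weigh (f a₁) a₀ (a₁ ^ f a₀) , weigh (f a₀) a₁ (a₀ ^ f a₁)
      where
      weigh : ∀ m a c → Weight.w m a c x * Weight.w m a c v ^ e ≡ Weight.w m a c v * Weight.w m a c u ^ e
      weigh m a c = begin
        w x * w v ^ e         ≡⟨ cong (w x *_) (W-^ e v≥1) ⟨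
        w x * W e (v ^ e)     ≡⟨ W-* 1 e x≥1 (^-pos e v≥1) ⟨
        W (1 + e) (x * v ^ e) ≡⟨ cong (W (1 + e)) eq ⟩
        W (1 + e) (v * u ^ e) ≡⟨ W-* 1 e v≥1 (^-pos e u≥1) ⟩
        w v * W e (u ^ e)     ≡⟨ cong (w v *_) (W-^ e u≥1) ⟩
        w v * w u ^ e         ∎
        where
        open Weight m a c

    private
      p q s t : ℕ
      p = L.w v
      q = R.w v
      s = L.w u
      t = R.w u

      collapse : ∀ {x} e → 1 ≤ x → On x → x * v ^ e ≡ v * u ^ e → (p * t) ^ e * q ≡ (q * s) ^ e * p
      collapse {x} e x≥1 ox eq with chain-ratio e x≥1 eq
      ... | l , r = *-cancelˡ (L-pos x≥1) (begin
        L.w x * ((p * t) ^ e * q)      ≡⟨ cong (λ k → L.w x * (k * q)) (^-distribʳ-* p t e) ⟩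
        L.w x * (p ^ e * t ^ e * q)    ≡⟨ solve 4 (λ x a b c → x :* (a :* b :* c) := x :* a :* (c :* b)) refl (L.w x) (p ^ e) (t ^ e) q ⟩
        L.w x * p ^ e * (q * t ^ e)    ≡⟨ cong₂ _*_ l (sym r) ⟩
        p * s ^ e * (R.w x * q ^ e)    ≡⟨ cong (λ k → p * s ^ e * (k * q ^ e)) ox ⟨
        p * s ^ e * (L.w x * q ^ e)    ≡⟨ solve 4 (λ c a x b → c :* a :* (x :* b) := x :* (b :* a :* c)) refl p (s ^ e) (L.w x) (q ^ e) ⟩
        L.w x * (q ^ e * s ^ e * p)    ≡⟨ cong (λ k → L.w x * (k * p)) (^-distribʳ-* q s e) ⟨
        L.w x * ((q * s) ^ e * p)      ∎)

    -- Along the chain the quotient `L.w / R.w` is geometric in the exponent. It is one at the two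
    -- distinct exponents of `a₀` and `a₁`, so its ratio and its initial value are both one.
    chain⇒on : Chain v u a₀ → Chain v u a₁ → ∀ {x} → 1 ≤ x → Chain v u x → On x
    chain⇒on (e₀ , c₀) (e₁ , c₁) {x} x≥1 (e , c) = *-cancelˡ (^-pos e p≥1) (begin
        p ^ e * L.w x  ≡⟨ *-comm (p ^ e) (L.w x) ⟩
        L.w x * p ^ e  ≡⟨ proj₁ (chain-ratio e x≥1 c) ⟩
        p * s ^ e      ≡⟨ cong₂ (λ a b → a * b ^ e) p≡q s≡t ⟩
        q * t ^ e      ≡⟨ proj₂ (chain-ratio e x≥1 c) ⟨
        R.w x * q ^ e  ≡⟨ cong (λ k → R.w x * k ^ e) p≡q ⟨
        R.w x * p ^ e  ≡⟨ *-comm (R.w x) (p ^ e) ⟩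
        p ^ e * R.w x  ∎)
      where
      p≥1 = L-pos v≥1
      q≥1 = R-pos v≥1
      s≥1 = L-pos u≥1
      t≥1 = R-pos u≥1
      α = p * t
      β = q * s
      E₀ : α ^ e₀ * q ≡ β ^ e₀ * p
      E₀ = collapse e₀ a₀≥1 on-a₀ c₀
      E₁ : α ^ e₁ * q ≡ β ^ e₁ * p
      E₁ = collapse e₁ a₁≥1 on-a₁ c₁
      e₀≢e₁ : e₀ ≢ e₁
      e₀≢e₁ refl = <⇒≢ a₀<a₁ (*-cancelˡ (^-pos e₀ v≥1)
        (trans (*-comm (v ^ e₀) a₀) (trans (trans c₀ (sym c₁)) (*-comm a₁ (v ^ e₀)))))
      α≡β : α ≡ β
      α≡β = ^-cross (*-pos p≥1 t≥1) (*-pos q≥1 s≥1) e₀≢e₁ (*-cancelˡ (*-pos p≥1 q≥1) (begin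
        p * q * (α ^ e₀ * β ^ e₁)    ≡⟨ solve 4 (λ p q a b → p :* q :* (a :* b) := a :* q :* (b :* p)) refl p q (α ^ e₀) (β ^ e₁) ⟩
        α ^ e₀ * q * (β ^ e₁ * p)    ≡⟨ cong₂ _*_ E₀ (sym E₁) ⟩
        β ^ e₀ * p * (α ^ e₁ * q)    ≡⟨ solve 4 (λ b p a q → b :* p :* (a :* q) := p :* q :* (a :* b)) refl (β ^ e₀) p (α ^ e₁) q ⟩
        p * q * (α ^ e₁ * β ^ e₀)    ∎))
      p≡q : p ≡ q
      p≡q = sym (*-cancelˡ (^-pos e₀ (*-pos p≥1 t≥1)) (trans E₀ (cong (λ k → k ^ e₀ * p) (sym α≡β))))
      s≡t : s ≡ t
      s≡t = sym (*-cancelˡ p≥1 (trans α≡β (cong (_* s) (sym p≡q))))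

  module Independent {γ : ℕ} (γ≥1 : 1 ≤ γ) (γ∉ : ¬ On γ) where

    Φ : ℕ → ℕ → ℕ → ℕ
    Φ i j l = a₀ ^ i * a₁ ^ j * γ ^ l

    private
      weigh : ∀ m a c i j l → Weight.W m a c (i + j + l) (Φ i j l) ≡
              Weight.w m a c a₀ ^ i * Weight.w m a c a₁ ^ j * Weight.w m a c γ ^ l
      weigh m a c i j l = begin
        W (i + j + l) (Φ i j l)                        ≡⟨ W-* (i + j) l (*-pos (^-pos i a₀≥1) (^-pos j a₁≥1)) (^-pos l γ≥1) ⟩
        W (i + j) (a₀ ^ i * a₁ ^ j) * W l (γ ^ l)      ≡⟨ cong₂ _*_ (W-* i j (^-pos i a₀≥1) (^-pos j a₁≥1)) (W-^ l γ≥1) ⟩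
        W i (a₀ ^ i) * W j (a₁ ^ j) * w γ ^ l          ≡⟨ cong (_* w γ ^ l) (cong₂ _*_ (W-^ i a₀≥1) (W-^ j a₁≥1)) ⟩
        w a₀ ^ i * w a₁ ^ j * w γ ^ l                  ∎
        where
        open Weight m a c

    -- The two weights agree at `a₀` and `a₁` but not at `γ`, so weighing the equation in both ways
    -- isolates the exponent of `γ`; the rest follows from `a₀ ≢ a₁`. Equal degree is essential, as
    -- `a₀` may be 1.
    Φ-injective : ∀ {i j l i' j' l'} → i + j + l ≡ i' + j' + l' → Φ i j l ≡ Φ i' j' l' →
                  i ≡ i' × j ≡ j' × l ≡ l'
    Φ-injective {i} {j} {l} {i'} {j'} {l'} deg eq = i≡ , +-cancelˡ-≡ i _ _ (trans ij≡ (cong (_+ j') (sym i≡))) , l≡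
      where
      P = L.w γ
      Q = R.w γ
      A = L.w a₀
      B = L.w a₁
      EL : A ^ i * B ^ j * P ^ l ≡ A ^ i' * B ^ j' * P ^ l'
      EL = trans (sym (weigh (f a₁) a₀ (a₁ ^ f a₀) i j l))
             (trans (cong₂ L.W deg eq) (weigh (f a₁) a₀ (a₁ ^ f a₀) i' j' l'))
      ER : A ^ i * B ^ j * Q ^ l ≡ A ^ i' * B ^ j' * Q ^ l'
      ER = subst₂ (λ A B → A ^ i * B ^ j * Q ^ l ≡ A ^ i' * B ^ j' * Q ^ l') (sym on-a₀) (sym on-a₁)
             (trans (sym (weigh (f a₀) a₁ (a₀ ^ f a₁) i j l))
             (trans (cong₂ R.W deg eq) (weigh (f a₀) a₁ (a₀ ^ f a₁) i' j' l')))
      X = A ^ i * B ^ j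
      X' = A ^ i' * B ^ j'
      pos : ∀ n k → 1 ≤ A ^ n * B ^ k
      pos n k = *-pos (^-pos n (L-pos a₀≥1)) (^-pos k (L-pos a₁≥1))
      cross : P ^ l * Q ^ l' ≡ P ^ l' * Q ^ l
      cross = *-cancelˡ (*-pos (pos i j) (pos i' j')) (begin
        X * X' * (P ^ l * Q ^ l')      ≡⟨ solve 4 (λ a b c d → a :* b :* (c :* d) := a :* c :* (b :* d)) refl X X' (P ^ l) (Q ^ l') ⟩
        X * P ^ l * (X' * Q ^ l')      ≡⟨ cong₂ _*_ EL (sym ER) ⟩
        X' * P ^ l' * (X * Q ^ l)      ≡⟨ solve 4 (λ a c b d → a :* c :* (b :* d) := b :* a :* (c :* d)) refl X' (P ^ l') X (Q ^ l) ⟩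
        X * X' * (P ^ l' * Q ^ l)      ∎)
      l≡ : l ≡ l'
      l≡ with l ≟ l'
      ... | yes p = p
      ... | no l≢ = contradiction (^-cross (L-pos γ≥1) (R-pos γ≥1) l≢ cross) γ∉
      ij≡ : i + j ≡ i' + j'
      ij≡ = +-cancelʳ-≡ l _ _ (trans deg (cong (i' + j' +_) (sym l≡)))
      low : a₀ ^ i * a₁ ^ j ≡ a₀ ^ i' * a₁ ^ j'
      low = *-cancelˡ (^-pos l γ≥1) (begin
        γ ^ l * (a₀ ^ i * a₁ ^ j)      ≡⟨ *-comm (γ ^ l) _ ⟩
        Φ i j l                        ≡⟨ eq ⟩
        Φ i' j' l'                     ≡⟨ cong (λ k → a₀ ^ i' * a₁ ^ j' * γ ^ k) l≡ ⟨
        a₀ ^ i' * a₁ ^ j' * γ ^ l      ≡⟨ *-comm _ (γ ^ l) ⟩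
        γ ^ l * (a₀ ^ i' * a₁ ^ j')    ∎)
      i≡ : i ≡ i'
      i≡ with i ≟ i'
      ... | yes p = p
      ... | no i≢ = contradiction (^-cross a₀≥1 a₁≥1 i≢ (*-cancelˡ (^-pos (j + j') a₁≥1) (begin
        a₁ ^ (j + j') * (a₀ ^ i * a₁ ^ i')       ≡⟨ cong (_* (a₀ ^ i * a₁ ^ i')) (^-distribˡ-+-* a₁ j j') ⟩
        a₁ ^ j * a₁ ^ j' * (a₀ ^ i * a₁ ^ i')    ≡⟨ solve 4 (λ a b c d → a :* b :* (c :* d) := c :* a :* (d :* b)) refl (a₁ ^ j) (a₁ ^ j') (a₀ ^ i) (a₁ ^ i') ⟩
        a₀ ^ i * a₁ ^ j * (a₁ ^ i' * a₁ ^ j')    ≡⟨ cong₂ _*_ low swap ⟩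
        a₀ ^ i' * a₁ ^ j' * (a₁ ^ i * a₁ ^ j)    ≡⟨ solve 4 (λ c b d a → c :* b :* (d :* a) := a :* b :* (c :* d)) refl (a₀ ^ i') (a₁ ^ j') (a₁ ^ i) (a₁ ^ j) ⟩
        a₁ ^ j * a₁ ^ j' * (a₀ ^ i' * a₁ ^ i)    ≡⟨ cong (_* (a₀ ^ i' * a₁ ^ i)) (^-distribˡ-+-* a₁ j j') ⟨
        a₁ ^ (j + j') * (a₀ ^ i' * a₁ ^ i)       ∎))) (<⇒≢ a₀<a₁)
        where
        swap : a₁ ^ i' * a₁ ^ j' ≡ a₁ ^ i * a₁ ^ j
        swap = trans (sym (^-distribˡ-+-* a₁ i' j')) (trans (cong (a₁ ^_) (sym ij≡)) (^-distribˡ-+-* a₁ i j))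

    Φ-+ : ∀ i j l i' j' l' → Φ i j l * Φ i' j' l' ≡ Φ (i + i') (j + j') (l + l')
    Φ-+ i j l i' j' l' rewrite ^-distribˡ-+-* a₀ i i' | ^-distribˡ-+-* a₁ j j' | ^-distribˡ-+-* γ l l' =
      solve 6 (λ a b c d e g → a :* b :* c :* (d :* e :* g) := a :* d :* (b :* e) :* (c :* g)) refl
        (a₀ ^ i) (a₁ ^ j) (γ ^ l) (a₀ ^ i') (a₁ ^ j') (γ ^ l')

    Φ-pos : ∀ i j l → 1 ≤ Φ i j l
    Φ-pos i j l = *-pos (*-pos (^-pos i a₀≥1) (^-pos j a₁≥1)) (^-pos l γ≥1)

  private
    -- Multiplying the two collinearity equations crosswise removes the constants and leaves `(x /
    -- y) ^ (f a₁ - f a₀) = (a₁ / a₀) ^ (f x - f y)`. Injectivity and monotonicity of `f` on the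
    -- line are read off from this.
    crossed : ∀ {x y} → 1 ≤ x → 1 ≤ y → On x → On y →
              x ^ f a₁ * y ^ f a₀ * (a₀ ^ f x * a₁ ^ f y) ≡ x ^ f a₀ * y ^ f a₁ * (a₀ ^ f y * a₁ ^ f x)
    crossed {x} {y} x≥1 y≥1 ox oy = *-cancelˡ (*-pos (^-pos 1 (^-pos (f a₀) a₁≥1)) (^-pos 1 (^-pos (f a₁) a₀≥1))) (begin
      C * D * (x ^ f a₁ * y ^ f a₀ * (a₀ ^ f x * a₁ ^ f y))
        ≡⟨ solve 6 (λ c d p q r s → c :* d :* (p :* q :* (r :* s)) := p :* r :* c :* (q :* s :* d)) refl C D (x ^ f a₁) (y ^ f a₀) (a₀ ^ f x) (a₁ ^ f y) ⟩
      L.w x * R.w y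
        ≡⟨ cong₂ _*_ ox (sym oy) ⟩
      R.w x * L.w y
        ≡⟨ solve 6 (λ c d p q r s → p :* s :* d :* (q :* r :* c) := c :* d :* (p :* q :* (r :* s))) refl C D (x ^ f a₀) (y ^ f a₁) (a₀ ^ f y) (a₁ ^ f x) ⟩
      C * D * (x ^ f a₀ * y ^ f a₁ * (a₀ ^ f y * a₁ ^ f x)) ∎)
      where
      C = (a₁ ^ f a₀) ^ 1
      D = (a₀ ^ f a₁) ^ 1

    power-< : ∀ {x y} d e → 1 ≤ x → y ≤ x → 1 ≤ e → y ^ d * a₀ ^ e < x ^ d * a₁ ^ e
    power-< {x} {y} d e x≥1 y≤x e≥1 = ≤-<-trans (*-monoˡ-≤ (a₀ ^ e) (^-monoˡ-≤ d y≤x))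
      (*-monoʳ-< (x ^ d) {{>-nonZero (^-pos d x≥1)}} (^-monoˡ-< e {{>-nonZero e≥1}} a₀<a₁))

    reduce : ∀ {x y} k d n e → 1 ≤ x → 1 ≤ y →
             x ^ (k + d) * y ^ k * (a₀ ^ n * a₁ ^ (n + e)) ≡ x ^ k * y ^ (k + d) * (a₀ ^ (n + e) * a₁ ^ n) →
             x ^ d * a₁ ^ e ≡ y ^ d * a₀ ^ e
    reduce {x} {y} k d n e x≥1 y≥1 eq
      rewrite ^-distribˡ-+-* x k d | ^-distribˡ-+-* y k d | ^-distribˡ-+-* a₀ n e | ^-distribˡ-+-* a₁ n e =
      *-cancelˡ (*-pos (*-pos (^-pos k x≥1) (^-pos k y≥1)) (*-pos (^-pos n a₀≥1) (^-pos n a₁≥1)))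
        (trans (solve 6 (λ a b c d x y → a :* b :* (c :* d) :* (x :* y) := a :* x :* b :* (c :* (d :* y))) refl
                  (x ^ k) (y ^ k) (a₀ ^ n) (a₁ ^ n) (x ^ d) (a₁ ^ e))
        (trans eq
               (solve 6 (λ a b c d x y → a :* (b :* x) :* (c :* y :* d) := a :* b :* (c :* d) :* (x :* y)) refl
                  (x ^ k) (y ^ k) (a₀ ^ n) (a₁ ^ n) (y ^ d) (a₀ ^ e))))

  on-injective : ∀ {x y} → 1 ≤ x → 1 ≤ y → On x → On y → f x ≡ f y → x ≡ y
  on-injective {x} {y} x≥1 y≥1 ox oy fx≡fy =
    ^-cross x≥1 y≥1 (f-sep ∘ sym) (*-cancelˡ (*-pos (^-pos (f y) a₀≥1) (^-pos (f y) a₁≥1))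
      (trans (*-comm _ (x ^ f a₁ * y ^ f a₀))
      (trans (subst (λ k → x ^ f a₁ * y ^ f a₀ * (a₀ ^ k * a₁ ^ f y) ≡ x ^ f a₀ * y ^ f a₁ * (a₀ ^ f y * a₁ ^ k)) fx≡fy
               (crossed x≥1 y≥1 ox oy))
             (*-comm (x ^ f a₀ * y ^ f a₁) _))))

  on-monotone : f a₀ < f a₁ → ∀ {x y} → 1 ≤ x → 1 ≤ y → On x → On y → f x < f y → x < y
  on-monotone f₀<f₁ {x} {y} x≥1 y≥1 ox oy fx<fy with m≤n⇒∃[o]m+o≡n (<⇒≤ f₀<f₁) | m≤n⇒∃[o]m+o≡n (<⇒≤ fx<fy)
  ... | d , p | e , q = ≰⇒> λ y≤x → <⇒≢ (power-< d e x≥1 y≤x e≥1) (sym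
      (reduce (f a₀) d (f x) e x≥1 y≥1 (subst₂ (λ m n → x ^ m * y ^ f a₀ * (a₀ ^ f x * a₁ ^ n) ≡ x ^ f a₀ * y ^ m * (a₀ ^ n * a₁ ^ f x))
        (sym p) (sym q) (crossed x≥1 y≥1 ox oy))))
    where
    e≥1 : 1 ≤ e
    e≥1 = n≢0⇒n>0 λ { refl → <⇒≢ fx<fy (trans (sym (+-identityʳ (f x))) q) }

  on-antitone : f a₁ < f a₀ → ∀ {x y} → 1 ≤ x → 1 ≤ y → On x → On y → f x < f y → y < x
  on-antitone f₁<f₀ {x} {y} x≥1 y≥1 ox oy fx<fy with m≤n⇒∃[o]m+o≡n (<⇒≤ f₁<f₀) | m≤n⇒∃[o]m+o≡n (<⇒≤ fx<fy)
  ... | d , p | e , q = ≰⇒> λ x≤y → <⇒≢ (power-< d e y≥1 x≤y e≥1)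
      (sym (reduce (f a₁) d (f x) e y≥1 x≥1 (subst₂ (λ m n → y ^ m * x ^ f a₁ * (a₀ ^ f x * a₁ ^ n) ≡ y ^ f a₁ * x ^ m * (a₀ ^ n * a₁ ^ f x))
        (sym p) (sym q) (trans (cong (_* (a₀ ^ f x * a₁ ^ f y)) (*-comm (y ^ f a₀) (x ^ f a₁)))
               (trans (crossed x≥1 y≥1 ox oy) (cong (_* (a₀ ^ f y * a₁ ^ f x)) (*-comm (x ^ f a₀) (y ^ f a₁))))))))
    where
    e≥1 : 1 ≤ e
    e≥1 = n≢0⇒n>0 λ { refl → <⇒≢ fx<fy (trans (sym (+-identityʳ (f x))) q) }

  -- f is strictly monotone on the line in one of the two directions.
  not-midpoint : ∀ {x y z} → 1 ≤ x → 1 ≤ y → 1 ≤ z → On x → On y → On z →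
                 f x < f y → f x < f z → x + x ≢ y + z
  not-midpoint x≥1 y≥1 z≥1 ox oy oz fx<fy fx<fz eq with <-cmp (f a₀) (f a₁)
  ... | tri< up _ _ = <⇒≢ (+-mono-< (on-monotone up x≥1 y≥1 ox oy fx<fy) (on-monotone up x≥1 z≥1 ox oz fx<fz)) eq
  ... | tri≈ _ same _ = f-sep same
  ... | tri> _ _ down = <⇒≢ (+-mono-< (on-antitone down x≥1 y≥1 ox oy fx<fy) (on-antitone down x≥1 z≥1 ox oz fx<fz)) (sym eq)

triangle : ℕ → ℕ
triangle zero = 0
triangle (suc n) = triangle n + suc n

module LineSums {ℓ : ℕ} (ℓ-prime : Prime ℓ) {a₀ a₁ : ℕ} (a₀≥1 : 1 ≤ a₀) (a₀<a₁ : a₀ < a₁)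
                (sep : Valuation.v ℓ-prime a₀ ≢ Valuation.v ℓ-prime a₁) where

  open Valuation ℓ-prime
  open Line v v-* a₀≥1 a₀<a₁ sep

  private
    Good : ℕ → Set
    Good x = 1 ≤ x × On x

    ^∣^ : ∀ {i j} → i ≤ j → ℓ ^ i ∣ ℓ ^ j
    ^∣^ {i} i≤j with m≤n⇒∃[o]m+o≡n i≤j
    ... | d , refl = subst (ℓ ^ i ∣_) (sym (^-distribˡ-+-* ℓ i d)) (m∣m*n (ℓ ^ d))

    -- If `v x < v y`, then `ℓ ^ (v x + 1)` divides every term except `x`. If `v x = v y`, then
    -- `x = y` because the valuation is injective on the line, and by monotonicity `x` is not the
    -- mean of two elements of larger valuation.
    low : ∀ {x y z t} → Good x → Good y → Good z → Good t →
          v x ≤ v y → v x < v z → v x < v t → x + y ≢ z + t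
    low {x} {y} {z} {t} (x≥1 , ox) (y≥1 , oy) (z≥1 , oz) (t≥1 , ot) x≤y x<z x<t eq with v x ≟ v y
    ... | yes same with refl ← on-injective x≥1 y≥1 ox oy same =
      not-midpoint x≥1 z≥1 t≥1 ox oz ot x<z x<t eq
    ... | no diff = <-irrefl refl (v-max x≥1 (∣m+n∣m⇒∣n (subst (ℓ ^ suc (v x) ∣_) (trans (sym eq) (+-comm x y))
            (∣m∣n⇒∣m+n (up x<z z≥1) (up x<t t≥1))) (up (≤∧≢⇒< x≤y diff) y≥1)))
      where
      up : ∀ {w} → v x < v w → 1 ≤ w → ℓ ^ suc (v x) ∣ w
      up lt w≥1 = ∣-trans (^∣^ lt) (v-∣ w≥1)

    ordered : ∀ {x y z t} → Good x → Good y → Good z → Good t →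
              v x ≤ v y → v z ≤ v t → x ≢ z → x + y ≢ z + t
    ordered {x} {y} {z} {t} gx gy gz gt xy zt x≢z eq with <-cmp (v x) (v z)
    ... | tri< x<z _ _ = low gx gy gz gt xy x<z (<-≤-trans x<z zt) eq
    ... | tri≈ _ same _ = x≢z (on-injective (proj₁ gx) (proj₁ gz) (proj₂ gx) (proj₂ gz) same)
    ... | tri> _ _ z<x = low gz gt gx gy zt z<x (<-≤-trans z<x xy) (sym eq)

  -- On a line distinct elements have distinct valuations: compare a term of least valuation.
  sums-distinct : ∀ {x y z t} → 1 ≤ x → 1 ≤ y → 1 ≤ z → 1 ≤ t → On x → On y → On z → On t →
                  x + y ≡ z + t → x ≡ z ⊎ x ≡ t
  sums-distinct {x} {y} {z} {t} px py pz pt ox oy oz ot eq with x ≟ z | x ≟ t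
  ... | yes x≡z | _ = inj₁ x≡z
  ... | no _ | yes x≡t = inj₂ x≡t
  ... | no x≢z | no x≢t = contradiction eq go
    where
    y≢z : y ≢ z
    y≢z refl = x≢t (+-cancelʳ-≡ y _ _ (trans eq (+-comm y t)))
    y≢t : y ≢ t
    y≢t refl = x≢z (+-cancelʳ-≡ y _ _ eq)
    go : x + y ≢ z + t
    go with ≤-total (v x) (v y) | ≤-total (v z) (v t)
    ... | inj₁ a | inj₁ b = ordered (px , ox) (py , oy) (pz , oz) (pt , ot) a b x≢z
    ... | inj₁ a | inj₂ b = ordered (px , ox) (py , oy) (pt , ot) (pz , oz) a b x≢t ∘ λ e → trans e (+-comm z t)
    ... | inj₂ a | inj₁ b = ordered (py , oy) (px , ox) (pz , oz) (pt , ot) a b y≢z ∘ trans (+-comm y x)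
    ... | inj₂ a | inj₂ b = ordered (py , oy) (px , ox) (pt , ot) (pz , oz) a b y≢t ∘ λ e → trans (+-comm y x) (trans e (+-comm z t))

  line-sums : ∀ {A} → AllPairs _>_ A → All (1 ≤_) A → All On A → triangle (length A) ≤ card (sumList A)
  line-sums {[]} _ _ _ = z≤n
  line-sums {u ∷ A} (u>A ∷ desc) (u≥1 ∷ pos) (ou ∷ on) = ≤-trans
    (+-monoˡ-≤ (suc (length A)) (line-sums desc pos on))
    (Growth.growth _+_ {u} {A} {u ∷ A} (+-cancelˡ-≡ u _ _) (All.map >⇒≢ u>A ∷ desc⇒unique desc) id fresh)
    where
    fresh : ∀ {x} → x ∈ u ∷ A → u + x ∉ sumList A
    fresh x∈ s∈ with Growth.∈-square⁻ _+_ A s∈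
    ... | y , z , y∈ , z∈ , eq with sums-distinct u≥1 (All.lookup (u≥1 ∷ pos) x∈) (All.lookup pos y∈) (All.lookup pos z∈)
                                     ou (All.lookup (ou ∷ on) x∈) (All.lookup on y∈) (All.lookup on z∈) eq
    ... | inj₁ refl = <-irrefl refl (All.lookup u>A y∈)
    ... | inj₂ refl = <-irrefl refl (All.lookup u>A z∈)

-- The search for sets with few products

nub : {A : Set} → (A → A → Bool) → List A → List A
nub eq [] = []
nub eq (x ∷ xs) = if any (eq x) xs then nub eq xs else x ∷ nub eq xs

nub-⊆ : {A : Set} (eq : A → A → Bool) (xs : List A) → nub eq xs ⊆ xs
nub-⊆ eq (x ∷ xs) y∈ with any (eq x) xs
... | true = there (nub-⊆ eq xs y∈)
nub-⊆ eq (x ∷ xs) (here refl) | false = here refl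
nub-⊆ eq (x ∷ xs) (there y∈) | false = there (nub-⊆ eq xs y∈)

nub-complete : {A : Set} (eq : A → A → Bool) → (∀ {x y} → T (eq x y) → x ≡ y) →
               ∀ {xs : List A} → xs ⊆ nub eq xs
nub-complete eq sound {x ∷ xs} y∈ with any (eq x) xs in found
nub-complete eq sound {x ∷ xs} (there y∈) | true = nub-complete eq sound y∈
nub-complete eq sound {x ∷ xs} (there y∈) | false = there (nub-complete eq sound y∈)
nub-complete eq sound {x ∷ xs} (here refl) | false = here refl
nub-complete {A} eq sound {x ∷ xs} (here refl) | true =
  nub-complete eq sound (Any.map sound (any⁻ (eq x) xs (Equivalence.from T-≡ found)))

-- The point (i , j , l) stands for the monomial a₀ ^ i * a₁ ^ j * γ ^ l.
Pt : Set
Pt = ℕ × ℕ × ℕ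

infixl 6 _⊕_ _⊖_

_⊕_ _⊖_ : Pt → Pt → Pt
(i , j , l) ⊕ (i' , j' , l') = i + i' , j + j' , l + l'
(i , j , l) ⊖ (i' , j' , l') = i ∸ i' , j ∸ j' , l ∸ l'

degree : Pt → ℕ
degree (i , j , l) = i + j + l

eqPt : Pt → Pt → Bool
eqPt (i , j , l) (i' , j' , l') = (i ≡ᵇ i') ∧ (j ≡ᵇ j') ∧ (l ≡ᵇ l')

eqPt-sound : ∀ {c c'} → T (eqPt c c') → c ≡ c'
eqPt-sound {i , j , l} {i' , j' , l'} t with Equivalence.to (T-∧ {i ≡ᵇ i'}) t
... | p , qr with Equivalence.to (T-∧ {j ≡ᵇ j'}) qr
... | q , r = cong₂ _,_ (≡ᵇ⇒≡ i i' p) (cong₂ _,_ (≡ᵇ⇒≡ j j' q) (≡ᵇ⇒≡ l l' r))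

eqPt-refl : ∀ c → T (eqPt c c)
eqPt-refl (i , j , l) = Equivalence.from T-∧ (≡⇒≡ᵇ i i refl , Equivalence.from T-∧ (≡⇒≡ᵇ j j refl , ≡⇒≡ᵇ l l refl))

memPt : Pt → List Pt → Bool
memPt c = any (eqPt c)

memPt-sound : ∀ {c P} → T (memPt c P) → c ∈ P
memPt-sound {c} {P} t = Any.map eqPt-sound (any⁻ (eqPt c) P t)

memPt-complete : ∀ {c P} → c ∈ P → T (memPt c P)
memPt-complete {c} c∈ = any⁺ (eqPt c) (Any.map (λ { refl → eqPt-refl c }) c∈)

orderedPairs : List Pt → List (Pt × Pt)
orderedPairs [] = []
orderedPairs (c ∷ P) = map (c ,_) P ++ orderedPairs P

-- All y z / x with x after y and z in the list.
candidates : List Pt → List Pt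
candidates [] = []
candidates (c ∷ P) = map ((c ⊕ c) ⊖_) P ++ (map (λ (z , x) → c ⊕ z ⊖ x) (orderedPairs P) ++ candidates P)

-- Counting with early exit keeps the evaluation of the search cheap.
atMost : {A : Set} → ℕ → (A → Bool) → List A → Bool
atMost k p [] = true
atMost k p (x ∷ xs) with p x
... | false = atMost k p xs
atMost zero p (x ∷ xs) | true = false
atMost (suc k) p (x ∷ xs) | true = atMost k p xs

atMost-complete : {A : Set} (k : ℕ) (p : A → Bool) (xs : List A) →
                  length (filterᵇ p xs) ≤ k → atMost k p xs ≡ true
atMost-complete k p [] _ = refl
atMost-complete k p (x ∷ xs) le with p x
... | false = atMost-complete k p xs le
atMost-complete (suc k) p (x ∷ xs) (s≤s le) | true = atMost-complete k p xs le

isNew : List Pt → Pt → Pt → Bool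
isNew S c x = not (memPt (c ⊕ x) S)

-- Every step adds at least three products, so a step with a fourth new one can never come back to
-- `3 k - 3`. The square of the added element counts, hence `c ∷ P`.
admissible : List Pt → List Pt → Pt → Bool
admissible S P c = not (memPt c P) ∧ atMost 3 (isNew S c) (c ∷ P)

-- Exponents add where elements multiply: this is the product set of the set that `P` stands for.
sums : List Pt → List Pt
sums P = nub eqPt (cartesianProductWith _⊕_ P P)

extensions : List Pt → List (List Pt)
extensions P = map (_∷ P) (filterᵇ (admissible (sums P) P) (nub eqPt (candidates P)))

-- The origin is placed at (20 , 20 , 20), so that no subtraction in the search is truncated.
rowPt : ℕ → Pt
rowPt i = 21 ∸ i , 20 + i , 20

-- Point `i` stands for `a₀ (a₁ / a₀) ^ i`, whose exponents sum to one; with the shift by 20 every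
-- point of the search has degree 61.
row : ℕ → List Pt
row zero = []
row (suc n) = rowPt n ∷ row n

start : ℕ → List Pt
start n = (20 , 20 , 21) ∷ row n

-- reach k contains the exponent lists of all sets of 3 + k elements, in decreasing order,
-- with exactly 3 (3 + k) - 3 products and multiplicative dimension two.
reach : ℕ → List (List Pt)
reach zero = start 2 ∷ []
reach (suc k) = start (3 + k) ∷ concatMap extensions (reach k)

-- The bounds satisfy `28 = 14 + 14`, so `y ⊕ z ⊖ x` is exact for points in the box; and
-- `61 = 3 * 20 + 1`.
inBox : Pt → Bool
inBox (i , j , l) = (i + j + l ≡ᵇ 61) ∧ (between i ∧ between j ∧ between l)
  where
  between : ℕ → Bool
  between n = (14 ≤ᵇ n) ∧ (n ≤ᵇ 28)

reach-inBox : ∀ k → k ≤ 6 → all (all inBox) (reach k) ≡ true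
reach-inBox 0 _ = refl
reach-inBox 1 _ = refl
reach-inBox 2 _ = refl
reach-inBox 3 _ = refl
reach-inBox 4 _ = refl
reach-inBox 5 _ = refl
reach-inBox 6 _ = refl
reach-inBox (suc (suc (suc (suc (suc (suc (suc _))))))) (s≤s (s≤s (s≤s (s≤s (s≤s (s≤s ()))))))

_≻_ : ℕ × Pt → ℕ × Pt → Set
p ≻ q = proj₁ p > proj₁ q

candidates-complete : ∀ {Z : List (ℕ × Pt)} → AllPairs _≻_ Z →
  ∀ {y z x} → y ∈ Z → z ∈ Z → x ∈ Z → proj₁ z ≤ proj₁ y → proj₁ x < proj₁ z →
  proj₂ y ⊕ proj₂ z ⊖ proj₂ x ∈ candidates (map proj₂ Z)
candidates-complete {h ∷ Z} (h> ∷ desc) {y} {z} {x} y∈ z∈ x∈ z≤y x<z with y∈ | z∈ | x∈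
... | here refl | here refl | here refl = contradiction x<z (<-irrefl refl)
... | here refl | here refl | there x∈' = ∈-++⁺ˡ (∈-map⁺ ((proj₂ h ⊕ proj₂ h) ⊖_) (∈-map⁺ proj₂ x∈'))
... | here refl | there z∈' | here refl = contradiction (<-trans x<z (All.lookup h> z∈')) (<-irrefl refl)
... | here refl | there z∈' | there x∈' = ∈-++⁺ʳ (map ((proj₂ h ⊕ proj₂ h) ⊖_) (map proj₂ Z))
      (∈-++⁺ˡ (∈-map⁺ (λ (z , x) → proj₂ h ⊕ z ⊖ x) (pair desc z∈' x∈' x<z)))
  where
  pair : ∀ {Z : List (ℕ × Pt)} → AllPairs _≻_ Z → ∀ {z x} → z ∈ Z → x ∈ Z → proj₁ x < proj₁ z →
         (proj₂ z , proj₂ x) ∈ orderedPairs (map proj₂ Z)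
  pair (h> ∷ _) (here refl) (here refl) x<z = contradiction x<z (<-irrefl refl)
  pair (h> ∷ _) {z} (here refl) (there x∈) x<z = ∈-++⁺ˡ (∈-map⁺ (proj₂ z ,_) (∈-map⁺ proj₂ x∈))
  pair (h> ∷ _) (there z∈) (here refl) x<z = contradiction (<-trans x<z (All.lookup h> z∈)) (<-irrefl refl)
  pair {h ∷ Z} (_ ∷ desc) (there z∈) (there x∈) x<z = ∈-++⁺ʳ (map (proj₂ h ,_) (map proj₂ Z)) (pair desc z∈ x∈ x<z)
... | there y∈' | here refl | _ = contradiction (≤-<-trans z≤y (All.lookup h> y∈')) (<-irrefl refl)
... | there y∈' | there z∈' | here refl = contradiction (<-trans x<z (All.lookup h> z∈')) (<-irrefl refl)
... | there y∈' | there z∈' | there x∈' = ∈-++⁺ʳ (map ((proj₂ h ⊕ proj₂ h) ⊖_) (map proj₂ Z))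
      (∈-++⁺ʳ (map (λ (z , x) → proj₂ h ⊕ z ⊖ x) (orderedPairs (map proj₂ Z)))
        (candidates-complete desc y∈' z∈' x∈' z≤y x<z))

-- Sets with few products

product-growth : ∀ {v A xs} → 1 ≤ v → Unique xs → xs ⊆ v ∷ A →
                 (∀ {x} → x ∈ xs → v * x ∉ prodList A) → card (prodList A) + length xs ≤ card (prodList (v ∷ A))
product-growth {v} {A} v≥1 = Growth.growth _*_ {v} {A} (*-cancelˡ v≥1)

top-new : ∀ {v x A} → 1 ≤ x → All (v >_) A → All (x ≥_) A → v * x ∉ prodList A
top-new {x = x} {A} x≥1 v> x≥ m with Growth.∈-square⁻ _*_ A m
... | y , z , y∈ , z∈ , eq = <⇒≢ (≤-<-trans (*-monoʳ-≤ y (All.lookup x≥ z∈))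
                                            (*-monoˡ-< x {{>-nonZero x≥1}} (All.lookup v> y∈))) (sym eq)

fourth-larger : ∀ {v x y z} → 1 ≤ x → y < v → v * x ≡ y * z → x < z
fourth-larger {v} {x} {y} {z} x≥1 y<v eq = ≰⇒> λ z≤x →
  <⇒≢ (≤-<-trans (*-monoʳ-≤ y z≤x) (*-monoˡ-< x {{>-nonZero x≥1}} y<v)) (sym eq)

GP : List ℕ → Set
GP (v ∷ u ∷ w ∷ A) = v * w ≡ u * u × GP (u ∷ w ∷ A)
GP _ = ⊤

two-new : ∀ {v u A} → AllPairs _>_ (v ∷ u ∷ A) → All (1 ≤_) (v ∷ u ∷ A) →
          v * v ∉ prodList (u ∷ A) × v * u ∉ prodList (u ∷ A)
two-new (v> ∷ u> ∷ _) (v≥1 ∷ u≥1 ∷ _) =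
  top-new v≥1 v> (All.map <⇒≤ v>) , top-new u≥1 v> (≤-refl ∷ All.map <⇒≤ u>)

third-product : ∀ {v u w A} → AllPairs _>_ (v ∷ u ∷ A) → All (1 ≤_) (v ∷ u ∷ A) → w ∈ A →
                v * w ∉ prodList (u ∷ A) → card (prodList (u ∷ A)) + 3 ≤ card (prodList (v ∷ u ∷ A))
third-product {v} {u} {w} {A} desc@((v>u ∷ v>) ∷ u> ∷ _) pos@(v≥1 ∷ _) w∈ w-new =
  product-growth {A = u ∷ A} {xs = v ∷ u ∷ w ∷ []} v≥1
    ((>⇒≢ v>u ∷ >⇒≢ (All.lookup v> w∈) ∷ []) ∷ (>⇒≢ (All.lookup u> w∈) ∷ []) ∷ [] ∷ [])
    (λ { (here refl) → here refl ; (there (here refl)) → there (here refl)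
       ; (there (there (here refl))) → there (there w∈) })
    λ { (here refl) → proj₁ (two-new desc pos) ; (there (here refl)) → proj₂ (two-new desc pos)
      ; (there (there (here refl))) → w-new }

-- Each new largest element brings `v v` and `v u`. If it brings nothing else, then `v w`, with `w`
-- the third largest, is an old product whose factors both exceed `w`; so both are `u`. One third
-- product at any stage improves the bound for good.
small-products⇒GP : ∀ {A} → AllPairs _>_ A → All (1 ≤_) A →
  let n = length A ; c = card (prodList A) in 2 * n ≤ 1 + c × (2 * n ≤ c ⊎ GP A)
small-products⇒GP {[]} _ _ = z≤n , inj₂ tt
small-products⇒GP {_ ∷ []} _ _ = ≤-refl , inj₂ tt
small-products⇒GP {v ∷ u ∷ A} desc@(v> ∷ u> ∷ _) pos@(v≥1 ∷ pos') with small-products⇒GP {u ∷ A} (AllPairs.tail desc) pos'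
... | low , alt = bound , decide A refl alt
  where
  c = card (prodList (v ∷ u ∷ A))
  c' = card (prodList (u ∷ A))
  n' = length (u ∷ A)
  grow₂ : c' + 2 ≤ c
  grow₂ = product-growth {A = u ∷ A} {xs = v ∷ u ∷ []} v≥1 ((>⇒≢ (All.head v>) ∷ []) ∷ [] ∷ [])
    (λ { (here refl) → here refl ; (there (here refl)) → there (here refl) })
    λ { (here refl) → proj₁ (two-new desc pos) ; (there (here refl)) → proj₂ (two-new desc pos) }
  double : 2 * suc n' ≡ 2 * n' + 2
  double = trans (*-suc 2 n') (+-comm 2 (2 * n'))
  bound : 2 * suc n' ≤ 1 + c
  bound = ≤-trans (≤-reflexive double) (≤-trans (+-monoˡ-≤ 2 low) (s≤s grow₂))
  decide : ∀ B → A ≡ B → 2 * n' ≤ c' ⊎ GP (u ∷ A) → 2 * suc n' ≤ c ⊎ GP (v ∷ u ∷ B)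
  decide [] _ _ = inj₂ tt
  decide (w ∷ B) refl alt with v * w ∈? prodList (u ∷ A)
  ... | no new = inj₁ (≤-trans (≤-reflexive double) (≤-trans (+-monoˡ-≤ 2 low)
          (≤-trans (≤-reflexive (sym (+-suc c' 2))) (third-product desc pos (here refl) new))))
  decide (w ∷ B) refl (inj₁ big) | yes old = inj₁ (≤-trans (≤-reflexive double) (≤-trans (+-monoˡ-≤ 2 big) grow₂))
  decide (w ∷ B) refl (inj₂ gp) | yes old with Growth.∈-square⁻ _*_ (u ∷ A) old
  ... | y , z , y∈ , z∈ , eq = inj₂ (trans eq (cong₂ _*_ (is-u y∈ z∈ eq) (is-u z∈ y∈ (trans eq (*-comm y z)))) , gp)
    where
    w<⇒u : ∀ {x} → x ∈ u ∷ A → w < x → x ≡ u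
    w<⇒u (here refl) _ = refl
    w<⇒u (there (here refl)) w<x = contradiction w<x (<-irrefl refl)
    w<⇒u (there (there x∈)) w<x with desc
    ... | _ ∷ _ ∷ (w> ∷ _) = contradiction (<-trans w<x (All.lookup w> x∈)) (<-irrefl refl)
    is-u : ∀ {y z} → y ∈ u ∷ A → z ∈ u ∷ A → v * w ≡ y * z → y ≡ u
    is-u {y} {z} y∈ z∈ eq = w<⇒u y∈ (fourth-larger (All.lookup pos' (there (here refl))) (All.lookup v> z∈) (trans eq (*-comm y z)))

-- Exact arithmetic with exponents

record Boxed (c : Pt) : Set where
  field
    deg : degree c ≡ 61
    lower : 14 ≤ proj₁ c × 14 ≤ proj₁ (proj₂ c) × 14 ≤ proj₂ (proj₂ c)
    upper : proj₁ c ≤ 28 × proj₁ (proj₂ c) ≤ 28 × proj₂ (proj₂ c) ≤ 28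

boxed : ∀ {c} → T (inBox c) → Boxed c
boxed {i , j , l} t with Equivalence.to (T-∧ {i + j + l ≡ᵇ 61}) t
... | d , t₁ with Equivalence.to (T-∧ {(14 ≤ᵇ i) ∧ (i ≤ᵇ 28)}) t₁
... | ti , t₂ with Equivalence.to (T-∧ {(14 ≤ᵇ j) ∧ (j ≤ᵇ 28)}) t₂
... | tj , tl with Equivalence.to (T-∧ {14 ≤ᵇ i}) ti | Equivalence.to (T-∧ {14 ≤ᵇ j}) tj | Equivalence.to (T-∧ {14 ≤ᵇ l}) tl
... | a , a' | b , b' | c , c' = record
  { deg = ≡ᵇ⇒≡ _ _ d
  ; lower = ≤ᵇ⇒≤ _ _ a , ≤ᵇ⇒≤ _ _ b , ≤ᵇ⇒≤ _ _ c
  ; upper = ≤ᵇ⇒≤ _ _ a' , ≤ᵇ⇒≤ _ _ b' , ≤ᵇ⇒≤ _ _ c' }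

reach-boxed : ∀ {k P c} → k ≤ 6 → P ∈ reach k → c ∈ P → Boxed c
reach-boxed {k} {P} k≤6 P∈ c∈ =
  boxed (All.lookup (all⁺ inBox P (All.lookup (all⁺ (all inBox) (reach k) (Equivalence.from T-≡ (reach-inBox k k≤6))) P∈)) c∈)

boxed-⊖ : ∀ {x y z} → Boxed x → Boxed y → Boxed z → (y ⊕ z ⊖ x) ⊕ x ≡ y ⊕ z
boxed-⊖ bx by bz with Boxed.upper bx | Boxed.lower by | Boxed.lower bz
... | i , j , l | i' , j' , l' | i'' , j'' , l'' =
  cong₂ _,_ (fits i i' i'') (cong₂ _,_ (fits j j' j'') (fits l l' l''))
  where
  fits : ∀ {x y z} → x ≤ 28 → 14 ≤ y → 14 ≤ z → y + z ∸ x + x ≡ y + z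
  fits x≤ y≥ z≥ = m∸n+n≡m (≤-trans x≤ (+-mono-≤ y≥ z≥))

degree-⊕ : ∀ c c' → degree (c ⊕ c') ≡ degree c + degree c'
degree-⊕ (i , j , l) (i' , j' , l') =
  solve 6 (λ i j l i' j' l' → i :+ i' :+ (j :+ j') :+ (l :+ l') := i :+ j :+ l :+ (i' :+ j' :+ l')) refl i j l i' j' l'
  where
  open +-*-Solver

sums-complete : ∀ {P c c'} → c ∈ P → c' ∈ P → c ⊕ c' ∈ sums P
sums-complete c∈ c'∈ = nub-complete eqPt eqPt-sound (∈-cartesianProductWith⁺ _⊕_ c∈ c'∈)

map-filterᵇ : {A B : Set} (g : A → B) (p : B → Bool) (xs : List A) →
              map g (filterᵇ (p ∘ g) xs) ≡ filterᵇ p (map g xs)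
map-filterᵇ g p [] = refl
map-filterᵇ g p (x ∷ xs) with p (g x)
... | true = cong (g x ∷_) (map-filterᵇ g p xs)
... | false = map-filterᵇ g p xs

¬T⇒T-not : ∀ b → ¬ T b → T (not b)
¬T⇒T-not true ¬t = ¬t tt
¬T⇒T-not false _ = tt

T-not⇒¬T : ∀ b → T (not b) → ¬ T b
T-not⇒¬T true () _

-- Classification by the growth of the product set

module ProductSet (f : ℕ → ℕ) (f-* : ∀ {x y} → 1 ≤ x → 1 ≤ y → f (x * y) ≡ f x + f y)
                  {a₀ a₁ : ℕ} (a₀≥1 : 1 ≤ a₀) (a₀<a₁ : a₀ < a₁) (f-sep : f a₀ ≢ f a₁) where

  open Line f f-* a₀≥1 a₀<a₁ f-sep

  -- If v w is an old product for every w below the two largest elements v > u, then every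
  -- element is v times a power of u / v.
  third-new : ∀ {v u A} → AllPairs _>_ (v ∷ u ∷ A) → All (1 ≤_) (v ∷ u ∷ A) →
              a₀ ∈ v ∷ u ∷ A → a₁ ∈ v ∷ u ∷ A → ¬ All On (v ∷ u ∷ A) →
              card (prodList (u ∷ A)) + 3 ≤ card (prodList (v ∷ u ∷ A))
  third-new {v} {u} {A} desc@(v> ∷ u> ∷ _) pos@(v≥1 ∷ u≥1 ∷ pos') a₀∈ a₁∈ ¬on
    with All.all? (λ w → v * w ∈? prodList (u ∷ A)) A
  ... | no ¬old with find (¬All⇒Any¬ (λ w → v * w ∈? prodList (u ∷ A)) A ¬old)
  ...   | w , w∈ , new = third-product desc pos w∈ new
  third-new {v} {u} {A} desc@(v> ∷ u> ∷ _) pos@(v≥1 ∷ u≥1 ∷ pos') a₀∈ a₁∈ ¬on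
      | yes old = contradiction (All.tabulate λ x∈ →
          chain⇒on v≥1 u≥1 (chained a₀∈) (chained a₁∈) (All.lookup pos x∈) (chained x∈)) ¬on
    where
    -- Induction on the distance from `v`: in `v x = y z` both factors lie below `v`, so both exceed
    -- `x`.
    chain-below : ∀ n {x} → v ∸ x < n → x ∈ v ∷ u ∷ A → Chain v u x
    chain-below _ _ (here refl) = 0 , refl
    chain-below _ _ (there (here refl)) = 1 , solve 2 (λ u v → u :* (v :* con 1) := v :* (u :* con 1)) refl u v
      where
      open +-*-Solver
    chain-below (suc n) {x} (s≤s le) (there (there x∈)) with Growth.∈-square⁻ _*_ (u ∷ A) (All.lookup old x∈)
    ... | y , z , y∈ , z∈ , eq = chain-fourth {y = y} {z} v≥1 eq (up y∈ x<y) (up z∈ x<z)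
      where
      x≥1 : 1 ≤ x
      x≥1 = All.lookup pos' x∈
      x<z : x < z
      x<z = fourth-larger x≥1 (All.lookup v> y∈) eq
      x<y : x < y
      x<y = fourth-larger x≥1 (All.lookup v> z∈) (trans eq (*-comm y z))
      up : ∀ {y} → y ∈ u ∷ A → x < y → Chain v u y
      up y∈ x<y = chain-below n (<-≤-trans (∸-monoʳ-< x<y (<⇒≤ (All.lookup v> y∈))) le) (there y∈)
    chained : ∀ {x} → x ∈ v ∷ u ∷ A → Chain v u x
    chained {x} = chain-below (suc (v ∸ x)) ≤-refl

  all-new : ∀ {v A} → AllPairs _>_ (v ∷ A) → All (1 ≤_) (v ∷ A) → (∀ {x} → x ∈ A → v * x ∉ prodList A) →
            card (prodList A) + suc (length A) ≤ card (prodList (v ∷ A))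
  all-new {v} {A} desc@(v> ∷ _) (v≥1 ∷ _) new = product-growth {xs = v ∷ A} v≥1 (desc⇒unique desc) id
    λ { (here refl) → top-new v≥1 v> (All.map <⇒≤ v>) ; (there x∈) → new x∈ }

  module Coordinates {γ : ℕ} (γ≥1 : 1 ≤ γ) (γ∉ : ¬ On γ) where

    open Independent γ≥1 γ∉ public

    Φₚ : Pt → ℕ
    Φₚ (i , j , l) = Φ i j l

    Φₚ-⊕ : ∀ c c' → Φₚ c * Φₚ c' ≡ Φₚ (c ⊕ c')
    Φₚ-⊕ (i , j , l) (i' , j' , l') = Φ-+ i j l i' j' l'

    Φₚ-pos : ∀ c → 1 ≤ Φₚ c
    Φₚ-pos (i , j , l) = Φ-pos i j l

    Φₚ-injective : ∀ {c c'} → degree c ≡ degree c' → Φₚ c ≡ Φₚ c' → c ≡ c'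
    Φₚ-injective {i , j , l} {i' , j' , l'} d e with Φ-injective {i} {j} {l} {i'} {j'} {l'} d e
    ... | refl , refl , refl = refl

    -- The shift of the origin in multiplicative form: after multiplication by `D`, an element with
    -- negative exponents is still a monomial.
    D : ℕ
    D = Φ 20 20 20

    record Rep (p : ℕ × Pt) : Set where
      constructor rep
      field scaled : D * proj₁ p ≡ Φₚ (proj₂ p)
    open Rep public

    D-pos : 1 ≤ D
    D-pos = Φ-pos 20 20 20

    rep-a₀ : Rep (a₀ , rowPt 0)
    rep-a₀ = rep (step 20 20 20)
      where
      open +-*-Solver
      step : ∀ i j l → Φ i j l * a₀ ≡ Φ (suc i) j l
      step i j l = solve 4 (λ a p q r → p :* q :* r :* a := a :* p :* q :* r) refl a₀ (a₀ ^ i) (a₁ ^ j) (γ ^ l)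

    rep-a₁ : Rep (a₁ , rowPt 1)
    rep-a₁ = rep (step 20 20 20)
      where
      open +-*-Solver
      step : ∀ i j l → Φ i j l * a₁ ≡ Φ i (suc j) l
      step i j l = solve 4 (λ a p q r → p :* q :* r :* a := p :* (a :* q) :* r) refl a₁ (a₀ ^ i) (a₁ ^ j) (γ ^ l)

    rep-γ : Rep (γ , 20 , 20 , 21)
    rep-γ = rep (step 20 20 20)
      where
      open +-*-Solver
      step : ∀ i j l → Φ i j l * γ ≡ Φ i j (suc l)
      step i j l = solve 4 (λ a p q r → p :* q :* r :* a := p :* q :* (a :* r)) refl γ (a₀ ^ i) (a₁ ^ j) (γ ^ l)

    rep-* : ∀ {x y cx cy} → Rep (x , cx) → Rep (y , cy) → D * D * (x * y) ≡ Φₚ (cx ⊕ cy)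
    rep-* {x} {y} {cx} {cy} rx ry = trans
      (solve 3 (λ d x y → d :* d :* (x :* y) := d :* x :* (d :* y)) refl D x y)
      (trans (cong₂ _*_ (scaled rx) (scaled ry)) (Φₚ-⊕ cx cy))
      where
      open +-*-Solver

    rep-fourth : ∀ {v x y z cv cx cy cz} → v * x ≡ y * z → cv ⊕ cx ≡ cy ⊕ cz →
                 Rep (x , cx) → Rep (y , cy) → Rep (z , cz) → Rep (v , cv)
    rep-fourth {v} {x} {y} {z} {cv} {cx} {cy} {cz} eq ceq rx ry rz = rep (*-cancelˡ (Φₚ-pos cx) (begin
      Φₚ cx * (D * v)    ≡⟨ cong (_* (D * v)) (scaled rx) ⟨
      D * x * (D * v)    ≡⟨ solve 3 (λ d x v → d :* x :* (d :* v) := d :* d :* (v :* x)) refl D x v ⟩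
      D * D * (v * x)    ≡⟨ cong (D * D *_) eq ⟩
      D * D * (y * z)    ≡⟨ rep-* ry rz ⟩
      Φₚ (cy ⊕ cz)       ≡⟨ cong Φₚ ceq ⟨
      Φₚ (cv ⊕ cx)       ≡⟨ Φₚ-⊕ cv cx ⟨
      Φₚ cv * Φₚ cx      ≡⟨ *-comm (Φₚ cv) (Φₚ cx) ⟩
      Φₚ cx * Φₚ cv      ∎))
      where
      open ≡-Reasoning
      open +-*-Solver

    -- Both sums of points have degree 122, and `Φₚ` is injective in each degree; hence every
    -- multiplicative coincidence is visible in the exponents.
    rep-equation : ∀ {x y z t cx cy cz ct} → degree cx ≡ 61 → degree cy ≡ 61 → degree cz ≡ 61 → degree ct ≡ 61 →
                   Rep (x , cx) → Rep (y , cy) → Rep (z , cz) → Rep (t , ct) → x * y ≡ z * t → cx ⊕ cy ≡ cz ⊕ ct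
    rep-equation {cx = cx} {cy} {cz} {ct} dx dy dz dt rx ry rz rt eq = Φₚ-injective
      (trans (degree-⊕ cx cy) (trans (cong₂ _+_ (trans dx (sym dz)) (trans dy (sym dt))) (sym (degree-⊕ cz ct))))
      (trans (sym (rep-* rx ry)) (trans (cong (D * D *_) eq) (rep-* rz rt)))

    -- With `a₀` and `a₁` as points 0 and 1 of the row, the relation `v w = u u` determines each
    -- further point from the two below it.
    gp-rep : ∀ pre → let A = pre ++ a₁ ∷ a₀ ∷ [] in GP A → length A ≤ 8 →
             ∃ λ Z → map proj₁ Z ≡ A × map proj₂ Z ≡ row (length A) × All Rep Z
    gp-rep [] _ _ = (a₁ , rowPt 1) ∷ (a₀ , rowPt 0) ∷ [] , refl , refl , rep-a₁ ∷ rep-a₀ ∷ []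
    gp-rep (v ∷ pre) gp le with gp-rep pre (GP-tail (pre ++ a₁ ∷ a₀ ∷ []) gp) (<⇒≤ le)
      where
      GP-tail : ∀ A → GP (v ∷ A) → GP A
      GP-tail [] _ = tt
      GP-tail (_ ∷ []) _ = tt
      GP-tail (_ ∷ _ ∷ _) (_ , gp) = gp
    ... | Z@((u , cu) ∷ (w , cw) ∷ Y) , eqA , eqP , ru ∷ rw ∷ rs =
      (v , rowPt (length A)) ∷ Z , cong (v ∷_) eqA , cong (rowPt (length A) ∷_) eqP , rv ∷ ru ∷ rw ∷ rs
      where
      A = pre ++ a₁ ∷ a₀ ∷ []
      len : length A ≡ suc (suc (length Y))
      len = trans (cong length (sym eqA)) (length-map proj₁ Z)
      -- Done by cases: truncation in `21 ∸ i` makes the identity fail for large `i`.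
      middle : ∀ i → i ≤ 5 → rowPt (suc (suc i)) ⊕ rowPt i ≡ rowPt (suc i) ⊕ rowPt (suc i)
      middle 0 _ = refl
      middle 1 _ = refl
      middle 2 _ = refl
      middle 3 _ = refl
      middle 4 _ = refl
      middle 5 _ = refl
      middle (suc (suc (suc (suc (suc (suc _)))))) (s≤s (s≤s (s≤s (s≤s (s≤s ())))))
      rv : Rep (v , rowPt (length A))
      rv = subst (λ m → Rep (v , rowPt m)) (sym len) (rep-fourth
        (proj₁ (subst (λ B → GP (v ∷ B)) (sym eqA) gp)) (middle n (+-cancelˡ-≤ 3 n 5 (subst (λ m → suc m ≤ 8) len le)))
        (subst (λ c → Rep (w , c)) (∷-injectiveˡ (∷-injectiveʳ coords)) rw) ru' ru')
        where
        n = length Y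
        coords : cu ∷ cw ∷ map proj₂ Y ≡ row (suc (suc n))
        coords = trans eqP (cong row len)
        ru' : Rep (u , rowPt (suc n))
        ru' = subst (λ c → Rep (u , c)) (∷-injectiveˡ coords) ru
    ... | [] , eqA , _ , _ = contradiction (trans (cong length eqA) (length-++ pre)) λ e → 0≢1+n (trans e (+-comm (length pre) 2))
    ... | _ ∷ [] , eqA , _ , _ = contradiction (trans (cong length eqA) (length-++ pre)) λ e → 0≢1+n (suc-injective (trans e (+-comm (length pre) 2)))

  record Tight (A : List ℕ) : Set where
    field
      γ : ℕ
      γ≥1 : 1 ≤ γ
      γ∉ : ¬ On γ
    open Coordinates γ≥1 γ∉ public
    field
      k : ℕ
      Z : List (ℕ × Pt)
      elements : map proj₁ Z ≡ A
      points : map proj₂ Z ∈ reach k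
      size : length A ≡ 3 + k
      reps : All Rep Z

  -- The relation places `v` at `cy ⊕ cz ⊖ cx`, one of the candidates of the search. A sum of points
  -- missing from `sums P` is a product missing from `prodList A`, so a candidate rejected for a
  -- fourth new sum accounts for four new products.
  extend : ∀ {v A x y z} → Tight A → AllPairs _>_ (v ∷ A) → All (1 ≤_) (v ∷ A) → length A ≤ 8 →
           x ∈ A → y ∈ A → z ∈ A → z ≤ y → v * x ≡ y * z →
           card (prodList A) + 4 ≤ card (prodList (v ∷ A)) ⊎ Tight (v ∷ A)
  extend {v} t@record { elements = refl } (v> ∷ desc) (v≥1 ∷ pos) le x∈ y∈ z∈ z≤y eq
    with ∈-map⁻ proj₁ x∈ | ∈-map⁻ proj₁ y∈ | ∈-map⁻ proj₁ z∈
  ... | (x , cx) , px∈ , refl | (y , cy) , py∈ , refl | (z , cz) , pz∈ , refl = decide (length (filterᵇ new (cv ∷ P)) ≤? 3)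
    where
    open Tight t
    A = map proj₁ Z
    P = map proj₂ Z
    cv = cy ⊕ cz ⊖ cx
    new : Pt → Bool
    new = isNew (sums P) cv
    k≤6 : k ≤ 6
    k≤6 = ≤-trans (+-cancelˡ-≤ 3 k 5 (subst (_≤ 8) size le)) (n≤1+n 5)
    box : ∀ {p} → p ∈ Z → Boxed (proj₂ p)
    box p∈ = reach-boxed k≤6 points (∈-map⁺ proj₂ p∈)
    deg : ∀ {p} → p ∈ Z → degree (proj₂ p) ≡ 61
    deg p∈ = Boxed.deg (box p∈)
    ceq : cv ⊕ cx ≡ cy ⊕ cz
    ceq = boxed-⊖ (box px∈) (box py∈) (box pz∈)
    rv : Rep (v , cv)
    rv = rep-fourth eq ceq (All.lookup reps px∈) (All.lookup reps py∈) (All.lookup reps pz∈)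
    deg-cv : degree cv ≡ 61
    deg-cv = +-cancelʳ-≡ 61 (degree cv) 61 (trans (cong (degree cv +_) (sym (deg px∈)))
      (trans (sym (degree-⊕ cv cx)) (trans (cong degree ceq) (trans (degree-⊕ cy cz) (cong₂ _+_ (deg py∈) (deg pz∈))))))
    x<z : x < z
    x<z = fourth-larger (All.lookup pos x∈) (All.lookup v> y∈) eq
    Z-desc : AllPairs _≻_ ((v , cv) ∷ Z)
    Z-desc = AllPairsₚ.map⁻ {f = proj₁} (v> ∷ desc)
    cv∉P : cv ∉ P
    cv∉P cv∈ with ∈-map⁻ proj₂ cv∈
    ... | (a , _) , a∈ , refl = <⇒≢ (All.lookup v> (∈-map⁺ proj₁ a∈))
      (*-cancelˡ D-pos (trans (scaled (All.lookup reps a∈)) (sym (scaled rv))))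
    new⇒new : ∀ {p} → p ∈ (v , cv) ∷ Z → T (new (proj₂ p)) → v * proj₁ p ∉ prodList A
    new⇒new {a , c} p∈ t∈ old with Growth.∈-square⁻ _*_ A old
    ... | y' , z' , y'∈ , z'∈ , eq' with ∈-map⁻ proj₁ y'∈ | ∈-map⁻ proj₁ z'∈
    ... | q , q∈ , refl | r , r∈ , refl = T-not⇒¬T (memPt (cv ⊕ c) (sums P)) t∈ (memPt-complete
      (subst (_∈ sums P) (sym (rep-equation deg-cv (deg' p∈) (deg q∈) (deg r∈) rv (All.lookup (rv ∷ reps) p∈)
                (All.lookup reps q∈) (All.lookup reps r∈) eq'))
        (sums-complete (∈-map⁺ proj₂ q∈) (∈-map⁺ proj₂ r∈))))
      where
      deg' : ∀ {p} → p ∈ (v , cv) ∷ Z → degree (proj₂ p) ≡ 61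
      deg' (here refl) = deg-cv
      deg' (there p∈) = deg p∈
    decide : Dec (length (filterᵇ new (cv ∷ P)) ≤ 3) → card (prodList A) + 4 ≤ card (prodList (v ∷ A)) ⊎ Tight (v ∷ A)
    decide (yes few) = inj₂ record
      { γ≥1 = γ≥1 ; γ∉ = γ∉ ; k = suc k ; Z = (v , cv) ∷ Z ; elements = refl
      ; points = there (∈-concatMap⁺ extensions (lose points
          (∈-map⁺ (_∷ P) (∈-filter⁺ (T? ∘ admissible (sums P) P)
            (nub-complete eqPt eqPt-sound (candidates-complete (AllPairs.tail Z-desc) py∈ pz∈ px∈ z≤y x<z))
            (Equivalence.from T-∧ (¬T⇒T-not (memPt cv P) (cv∉P ∘ memPt-sound) ,
                                   Equivalence.from T-≡ (atMost-complete 3 new (cv ∷ P) few)))))))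
      ; size = cong suc size ; reps = rv ∷ reps }
    decide (no many) = inj₁ (≤-trans (+-monoʳ-≤ (card (prodList A)) (≤-trans (≰⇒> many) (≤-reflexive same-length)))
      (product-growth {A = A} {xs} v≥1 (AllPairsₚ.map⁺ (AllPairs.map >⇒≢ (AllPairsₚ.filter⁺ (T? ∘ new ∘ proj₂) Z-desc))) xs⊆ fresh))
      where
      N = filterᵇ (new ∘ proj₂) ((v , cv) ∷ Z)
      xs = map proj₁ N
      same-length : length (filterᵇ new (cv ∷ P)) ≡ length xs
      same-length = trans (cong length (sym (map-filterᵇ proj₂ new ((v , cv) ∷ Z)))) (trans (length-map proj₂ N) (sym (length-map proj₁ N)))
      xs⊆ : xs ⊆ v ∷ A
      xs⊆ a∈ with ∈-map⁻ proj₁ a∈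
      ... | p , p∈ , refl = ∈-map⁺ proj₁ (proj₁ (∈-filter⁻ (T? ∘ new ∘ proj₂) p∈))
      fresh : ∀ {a} → a ∈ xs → v * a ∉ prodList A
      fresh a∈ with ∈-map⁻ proj₁ a∈
      ... | p , p∈ , refl with ∈-filter⁻ (T? ∘ new ∘ proj₂) {xs = (v , cv) ∷ Z} p∈
      ... | p∈Z , p-new = new⇒new p∈Z p-new

  -- With `n` elements, `big` means at least `3 n - 2` products and `tight` at least `3 n - 3`; the
  -- constants stand on the right to avoid truncated subtraction.
  data Outcome (A : List ℕ) : Set where
    line : All On A → Outcome A
    big : 3 * length A ≤ 2 + card (prodList A) → Outcome A
    tight : 3 * length A ≤ 3 + card (prodList A) → Tight A → Outcome A

  three-new : ∀ {v A} → AllPairs _>_ (v ∷ A) → All (1 ≤_) (v ∷ A) → a₀ ∈ A → a₁ ∈ A → ¬ All On (v ∷ A) →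
              card (prodList A) + 3 ≤ card (prodList (v ∷ A))
  three-new {A = _ ∷ _} desc pos a₀∈ a₁∈ = third-new desc pos (there a₀∈) (there a₁∈)

  classify : ∀ pre → let A = pre ++ a₁ ∷ a₀ ∷ [] in
             AllPairs _>_ A → All (1 ≤_) A → length A ≤ 9 → Outcome A
  classify [] _ _ _ = line (on-a₁ ∷ on-a₀ ∷ [])
  classify (v ∷ pre) desc@(v> ∷ desc') pos@(v≥1 ∷ pos') (s≤s le)
    with All.all? on? (v ∷ pre ++ a₁ ∷ a₀ ∷ [])
  ... | yes on = line on
  ... | no ¬on = combine (classify pre desc' pos' (m≤n⇒m≤1+n le))
    where
    A = pre ++ a₁ ∷ a₀ ∷ []
    c = card (prodList A)
    c⁺ = card (prodList (v ∷ A))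

    size : length A ≡ 2 + length pre
    size = trans (length-++ pre) (+-comm (length pre) 2)

    three : c + 3 ≤ c⁺
    three = three-new desc pos (∈-++⁺ʳ pre (there (here refl))) (∈-++⁺ʳ pre (here refl)) ¬on

    -- `e` is the deficit against three products per element: a further element costs three, and `d`
    -- new products pay for it.
    step : ∀ e d e' → 3 * length A ≤ e + c → c + d ≤ c⁺ → 3 + e ≡ e' + d → 3 * suc (length A) ≤ e' + c⁺
    step e d e' b grow eq = begin
      3 * suc (length A)    ≡⟨ *-suc 3 (length A) ⟩
      3 + 3 * length A      ≤⟨ +-monoʳ-≤ 3 b ⟩
      3 + (e + c)           ≡⟨ +-assoc 3 e c ⟨
      3 + e + c             ≡⟨ cong (_+ c) eq ⟩
      e' + d + c            ≡⟨ +-assoc e' d c ⟩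
      e' + (d + c)          ≡⟨ cong (e' +_) (+-comm d c) ⟩
      e' + (c + d)          ≤⟨ +-monoʳ-≤ e' grow ⟩
      e' + c⁺               ∎
      where
      open ≤-Reasoning

    combine : Outcome A → Outcome (v ∷ A)
    combine (big b) = big (step 2 3 2 b three refl)
    -- An old product `v x = y z` would put `v` on the line, so all `n + 1` products of `v` are new.
    -- Added to `2 n - 1` they make `3 (n + 1) - 3`.
    combine (line on) = independent (small-products⇒GP desc' pos')
      where
      v∉ : ¬ On v
      v∉ ov = ¬on (ov ∷ on)
      grow : c + suc (length A) ≤ c⁺
      grow = all-new desc pos λ x∈ old → let y , z , y∈ , z∈ , eq = Growth.∈-square⁻ _*_ A old in
        v∉ (on-fourth v≥1 (All.lookup pos' x∈) (All.lookup pos' y∈) (All.lookup pos' z∈)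
              (All.lookup on x∈) (All.lookup on y∈) (All.lookup on z∈) eq)
      bound : ∀ e → 2 * length A ≤ e + c → 3 * suc (length A) ≤ e + 2 + c⁺
      bound e b = begin
        3 * suc (length A)                  ≡⟨ solve 1 (λ n → con 3 :* (con 1 :+ n) := con 2 :* n :+ (con 2 :+ (con 1 :+ n))) refl (length A) ⟩
        2 * length A + (2 + suc (length A)) ≤⟨ +-monoˡ-≤ (2 + suc (length A)) b ⟩
        e + c + (2 + suc (length A))        ≡⟨ solve 3 (λ e c m → e :+ c :+ (con 2 :+ m) := e :+ con 2 :+ (c :+ m)) refl e c (suc (length A)) ⟩
        e + 2 + (c + suc (length A))        ≤⟨ +-monoʳ-≤ (e + 2) grow ⟩
        e + 2 + c⁺                          ∎
        where
        open ≤-Reasoning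
        open +-*-Solver
      independent : 2 * length A ≤ 1 + c × (2 * length A ≤ c ⊎ GP A) → Outcome (v ∷ A)
      independent (_ , inj₁ b) = big (bound 0 b)
      independent (b , inj₂ gp) with Coordinates.gp-rep v≥1 v∉ pre gp le
      ... | Z , elements , points , reps = tight (bound 1 b) record
        { γ≥1 = v≥1 ; γ∉ = v∉ ; k = length pre ; Z = (v , 20 , 20 , 21) ∷ Z ; elements = cong (v ∷_) elements
        ; points = start∈ (length pre) (cong ((20 , 20 , 21) ∷_) (trans points (cong row size)))
        ; size = cong suc size ; reps = Coordinates.rep-γ v≥1 v∉ ∷ reps }
        where
        start∈ : ∀ k {P} → P ≡ start (2 + k) → P ∈ reach k
        start∈ zero refl = here refl
        start∈ (suc k) refl = here refl
    -- If no `v x` with `x` in `A` is old, these products and `v v` are new, at least four in all.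
    -- Otherwise an old one exhibits `v` as a quotient of elements of `A`.
    combine (tight b t) with Any.any? (λ x → v * x ∈? prodList A) A
    ... | no none = big (step 3 4 2 b (≤-trans (+-monoʳ-≤ c 4≤) (all-new desc pos λ x∈ old → none (lose x∈ old))) refl)
      where
      4≤ : 4 ≤ suc (length A)
      4≤ = s≤s (≤-trans (m≤m+n 3 (Tight.k t)) (≤-reflexive (sym (Tight.size t))))
    ... | yes some with find some
    ... | x , x∈ , old with Growth.∈-square⁻ _*_ A old
    ... | y , z , y∈ , z∈ , eq = finish (≤-total z y)
      where
      close : c + 4 ≤ c⁺ ⊎ Tight (v ∷ A) → Outcome (v ∷ A)
      close (inj₁ four) = big (step 3 4 2 b four refl)
      close (inj₂ t') = tight (step 3 3 3 b three refl) t'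
      finish : z ≤ y ⊎ y ≤ z → Outcome (v ∷ A)
      finish (inj₁ z≤y) = close (extend t desc pos le x∈ y∈ z∈ z≤y eq)
      finish (inj₂ y≤z) = close (extend t desc pos le x∈ z∈ y∈ y≤z (trans eq (*-comm y z)))

-- Homogeneous sums of monomials

-- (e , f) stands for p ^ e * q ^ f.
Mono : Set
Mono = ℕ × ℕ

evMono : ℕ → ℕ → Mono → ℕ
evMono p q (e , f) = p ^ e * q ^ f

ev : ℕ → ℕ → List Mono → ℕ
ev p q [] = 0
ev p q (m ∷ L) = evMono p q m + ev p q L

_⊞_ : Mono → Mono → Mono
(e , f) ⊞ (e' , f') = e + e' , f + f'

_⊗_ : List Mono → List Mono → List Mono
_⊗_ = cartesianProductWith _⊞_

ev-++ : ∀ p q L R → ev p q (L ++ R) ≡ ev p q L + ev p q R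
ev-++ p q [] R = refl
ev-++ p q (m ∷ L) R = trans (cong (evMono p q m +_) (ev-++ p q L R)) (sym (+-assoc (evMono p q m) _ _))

ev-⊗ : ∀ p q L R → ev p q (L ⊗ R) ≡ ev p q L * ev p q R
ev-⊗ p q [] R = refl
ev-⊗ p q (m ∷ L) R = trans (ev-++ p q (map (m ⊞_) R) (L ⊗ R))
  (trans (cong₂ _+_ (shifted R) (ev-⊗ p q L R)) (sym (*-distribʳ-+ (ev p q R) (evMono p q m) (ev p q L))))
  where
  open +-*-Solver
  shift : ∀ m n → evMono p q (m ⊞ n) ≡ evMono p q m * evMono p q n
  shift (e , f) (e' , f') rewrite ^-distribˡ-+-* p e e' | ^-distribˡ-+-* q f f' =
    solve 4 (λ a b c d → a :* b :* (c :* d) := a :* c :* (b :* d)) refl (p ^ e) (p ^ e') (q ^ f) (q ^ f')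
  shifted : ∀ R → ev p q (map (m ⊞_) R) ≡ evMono p q m * ev p q R
  shifted [] = sym (*-zeroʳ (evMono p q m))
  shifted (n ∷ R) = trans (cong₂ _+_ (shift m n) (shifted R)) (sym (*-distribˡ-+ (evMono p q m) (evMono p q n) (ev p q R)))

length-⊗ : ∀ L R → length (L ⊗ R) ≡ length L * length R
length-⊗ [] R = refl
length-⊗ (m ∷ L) R = trans (length-++ (map (m ⊞_) R)) (cong₂ _+_ (length-map (m ⊞_) R) (length-⊗ L R))

Homogeneous : ℕ → List Mono → Set
Homogeneous d = All λ (e , f) → e + f ≡ d

homogeneous-++ : ∀ {d L R} → Homogeneous d L → Homogeneous d R → Homogeneous d (L ++ R)
homogeneous-++ [] hr = hr
homogeneous-++ (h ∷ hl) hr = h ∷ homogeneous-++ hl hr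

homogeneous-⊗ : ∀ {d d' L R} → Homogeneous d L → Homogeneous d' R → Homogeneous (d + d') (L ⊗ R)
homogeneous-⊗ [] hr = []
homogeneous-⊗ {d} {d'} {m@(e , f) ∷ L} (h ∷ hl) hr = homogeneous-++ (shifted hr) (homogeneous-⊗ hl hr)
  where
  open +-*-Solver
  shifted : ∀ {R} → Homogeneous d' R → Homogeneous (d + d') (map (m ⊞_) R)
  shifted [] = []
  shifted {(e' , f') ∷ R} (h' ∷ hr) = trans
    (solve 4 (λ a b c d → a :+ b :+ (c :+ d) := a :+ c :+ (b :+ d)) refl e e' f f') (cong₂ _+_ h h') ∷ shifted hr

-- The coefficient of `q ^ d`, that is, the lowest digit in an expansion by powers of `p`; `lowered`
-- is the remaining part divided by `p`.
constants : List Mono → ℕ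
constants [] = 0
constants ((zero , _) ∷ L) = suc (constants L)
constants ((suc _ , _) ∷ L) = constants L

lowered : List Mono → List Mono
lowered [] = []
lowered ((zero , _) ∷ L) = lowered L
lowered ((suc e , f) ∷ L) = (e , f) ∷ lowered L

ev-split : ∀ p q {d L} → Homogeneous d L → ev p q L ≡ constants L * q ^ d + p * ev p q (lowered L)
ev-split p q [] = sym (*-zeroʳ p)
ev-split p q {d} {(zero , f) ∷ L} (refl ∷ h) rewrite ev-split p q h =
  solve 3 (λ Q c r → con 1 :* Q :+ (c :* Q :+ r) := (con 1 :+ c) :* Q :+ r) refl (q ^ f) (constants L) (p * ev p q (lowered L))
  where
  open +-*-Solver
ev-split p q {d} {(suc e , f) ∷ L} (_ ∷ h) rewrite ev-split p q h =
  solve 5 (λ p x y z r → p :* x :* y :+ (z :+ p :* r) := z :+ p :* (x :* y :+ r)) refl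
    p (p ^ e) (q ^ f) (constants L * q ^ d) (ev p q (lowered L))
  where
  open +-*-Solver

lowered-homogeneous : ∀ {d L} → Homogeneous (suc d) L → Homogeneous d (lowered L)
lowered-homogeneous [] = []
lowered-homogeneous {L = (zero , _) ∷ _} (_ ∷ h) = lowered-homogeneous h
lowered-homogeneous {L = (suc _ , _) ∷ _} (eq ∷ h) = suc-injective eq ∷ lowered-homogeneous h

lowered-constant : ∀ {L} → Homogeneous 0 L → lowered L ≡ []
lowered-constant [] = refl
lowered-constant {(zero , _) ∷ _} (_ ∷ h) = lowered-constant h
lowered-constant {(suc _ , _) ∷ _} (() ∷ _)

constants≤ : ∀ L → constants L ≤ length L
constants≤ [] = z≤n
constants≤ ((zero , _) ∷ L) = s≤s (constants≤ L)
constants≤ ((suc _ , _) ∷ L) = m≤n⇒m≤1+n (constants≤ L)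

lowered≤ : ∀ L → length (lowered L) ≤ length L
lowered≤ [] = z≤n
lowered≤ ((zero , _) ∷ L) = m≤n⇒m≤1+n (lowered≤ L)
lowered≤ ((suc _ , _) ∷ L) = s≤s (lowered≤ L)

module _ {p q : ℕ} (coprime : Coprime p q) where

  ∣-drop-power : ∀ d {k} → p ∣ k * q ^ d → p ∣ k
  ∣-drop-power zero {k} h = subst (p ∣_) (*-identityʳ k) h
  ∣-drop-power (suc d) {k} h = ∣-drop-power d (coprime-divisor coprime (subst (p ∣_)
    (solve 3 (λ k q r → k :* (q :* r) := q :* (k :* r)) refl k q (q ^ d)) h))
    where
    open +-*-Solver

  -- Modulo `p` the equation says `(z' - z) q ^ d = 0`. Coprimality removes the power of `q`, and
  -- `z' - z < p` leaves only zero.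
  digit-≤ : ∀ d {z z' E E'} → z ≤ z' → z' < p → z * q ^ d + p * E ≡ z' * q ^ d + p * E' → z ≡ z'
  digit-≤ d {z} {z'} {E} {E'} z≤z' z'<p eq with m≤n⇒∃[o]m+o≡n z≤z'
  ... | zero , refl = sym (+-identityʳ z)
  ... | k@(suc _) , refl = contradiction (∣⇒≤ (∣-drop-power d p∣)) (<⇒≱ (≤-<-trans (m≤n+m k z) z'<p))
    where
    open +-*-Solver
    p∣ : p ∣ k * q ^ d
    p∣ = ∣m+n∣m⇒∣n (subst (p ∣_) (+-cancelˡ-≡ (z * q ^ d) _ _ (trans eq
      (solve 4 (λ z k Q r → (z :+ k) :* Q :+ r := z :* Q :+ (r :+ k :* Q)) refl z k (q ^ d) (p * E'))))
      (m∣m*n E)) (m∣m*n E')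

  digit : ∀ d {z z' E E'} → z < p → z' < p → z * q ^ d + p * E ≡ z' * q ^ d + p * E' → z ≡ z'
  digit d {z} {z'} z< z'< eq with ≤-total z z'
  ... | inj₁ le = digit-≤ d le z'< eq
  ... | inj₂ ge = sym (digit-≤ d ge z< (sym eq))

  -- Fewer than p monomials of equal degree: comparing modulo p, digit by digit, an equation
  -- at (p , q) is an identity of polynomials.
  homogeneous-identity : 9 ≤ p → ∀ d {L R} → Homogeneous d L → Homogeneous d R →
    length L ≤ 8 → length R ≤ 8 → ev p q L ≡ ev p q R → ∀ p' q' → ev p' q' L ≡ ev p' q' R
  homogeneous-identity p≥9 d {L} {R} hl hr ll lr eq p' q' =
    trans (ev-split p' q' hl) (trans (cong₂ (λ z e → z * q' ^ d + p' * e) z≡ (rest d hl hr E≡)) (sym (ev-split p' q' hr)))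
    where
    split≡ : constants L * q ^ d + p * ev p q (lowered L) ≡ constants R * q ^ d + p * ev p q (lowered R)
    split≡ = trans (sym (ev-split p q hl)) (trans eq (ev-split p q hr))
    z≡ : constants L ≡ constants R
    z≡ = digit d (≤-trans (s≤s (≤-trans (constants≤ L) ll)) p≥9) (≤-trans (s≤s (≤-trans (constants≤ R) lr)) p≥9) split≡
    E≡ : ev p q (lowered L) ≡ ev p q (lowered R)
    E≡ = *-cancelˡ (≤-trans (s≤s z≤n) p≥9) (+-cancelˡ-≡ (constants L * q ^ d) _ _
      (trans split≡ (cong (λ z → z * q ^ d + p * ev p q (lowered R)) (sym z≡))))
    rest : ∀ d → Homogeneous d L → Homogeneous d R → ev p q (lowered L) ≡ ev p q (lowered R) →
           ev p' q' (lowered L) ≡ ev p' q' (lowered R)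
    rest zero hl hr _ = cong (ev p' q') (trans (lowered-constant hl) (sym (lowered-constant hr)))
    rest (suc d) hl hr e = homogeneous-identity p≥9 d (lowered-homogeneous hl) (lowered-homogeneous hr)
      (≤-trans (lowered≤ L) ll) (≤-trans (lowered≤ R) lr) e p' q'

-- Sums of two geometric progressions

-- A sum of two elements of the rows X (p / q) ^ i, Y (p / q) ^ j, both scaled by q ^ 5.
data Item : Set where
  UU UW WW : ℕ → ℕ → Item

-- The rows have at most six terms, so `q ^ 5` clears every denominator and all terms become
-- homogeneous of degree 5.
power : ℕ → Mono
power i = i , 5 ∸ i

us ws : Item → List Mono
us (UU i j) = power i ∷ power j ∷ []
us (UW i j) = power i ∷ []
us (WW i j) = []
ws (UU i j) = []
ws (UW i j) = power j ∷ []
ws (WW i j) = power i ∷ power j ∷ []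

triangular : (ℕ → ℕ → Item) → ℕ → List Item
triangular c s = concatMap (λ j → map (λ i → c i j) (upTo (suc j))) (upTo s)

items : ℕ → ℕ → List Item
items s t = triangular UU s ++ (cartesianProductWith UW (upTo s) (upTo t) ++ triangular WW t)

values : ℕ → ℕ → Item → ℕ × ℕ
values p q σ = ev p q (us σ) , ev p q (ws σ)

-- A coincidence of `σ` and `τ` gives `X : Y = (wτ - wσ) : (uσ - uτ)`. Up to a common factor a sum
-- `X u + Y w` is then `(wτ - wσ) u + (uσ - uτ) w`, kept as the pair of its positive and negative
-- parts; `eqKey` compares such differences.
key : ℕ × ℕ → ℕ × ℕ → ℕ × ℕ → ℕ × ℕ
key (uσ , wσ) (uτ , wτ) (u , w) = wτ * u + uσ * w , wσ * u + uτ * w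

eqKey : ℕ × ℕ → ℕ × ℕ → Bool
eqKey (a , b) (a' , b') = a + b' ≡ᵇ a' + b

-- For the ratio `X : Y` forced by the coincidence this is `X a = Y b`.
commensurable : ℕ → ℕ → ℕ × ℕ → ℕ × ℕ → Bool
commensurable a b (uσ , wσ) (uτ , wτ) = uσ * b + wσ * a ≡ᵇ wτ * a + uτ * b

-- Here `Y / X` would be a power of `p / q` with exponent between -5 and 5, so that both rows lie on
-- one progression; this is excluded by the choice of the rows.
dependent : ℕ → ℕ → ℕ × ℕ → ℕ × ℕ → Bool
dependent p q s t = any (λ e → commensurable (ev p q (power e ∷ [])) (ev p q (power 0 ∷ [])) s t
                             ∨ commensurable (ev p q (power 0 ∷ [])) (ev p q (power e ∷ [])) s t) (upTo 6)

-- If the sums σ and τ coincide, then X : Y is known, and the number of sums can be computed.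
collision-ok : ℕ → ℕ → ℕ → List (ℕ × ℕ) → ℕ × ℕ → ℕ × ℕ → Bool
collision-ok N p q V (uσ , wσ) (uτ , wτ) =
  if uσ ≡ᵇ uτ then not (wσ ≡ᵇ wτ)
  else if wσ ≡ᵇ wτ then true
  else (dependent p q (uσ , wσ) (uτ , wτ) ∨ (N ≤ᵇ length (nub eqKey (map (key (uσ , wσ) (uτ , wτ)) V))))

allPairsᵇ : {A : Set} → (A → A → Bool) → List A → Bool
allPairsᵇ r [] = true
allPairsᵇ r (x ∷ xs) = all (r x) xs ∧ allPairsᵇ r xs

bounded : Item → Bool
bounded (UU i j) = (i ≤ᵇ 5) ∧ (j ≤ᵇ 5)
bounded (UW i j) = (i ≤ᵇ 5) ∧ (j ≤ᵇ 5)
bounded (WW i j) = (i ≤ᵇ 5) ∧ (j ≤ᵇ 5)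

-- The bound on `length (items s t)` settles the case of no coincidence at all. The last condition
-- obtains the count from any single coincidence.
check : ℕ → ℕ → ℕ → ℕ → ℕ → Bool
check s t N p q = let V = map (values p q) (items s t) in
  (N ≤ᵇ length (items s t)) ∧ (all bounded (items s t) ∧ allPairsᵇ (collision-ok N p q V) V)

allPairsᵇ-sound : {A : Set} (r : A → A → Bool) (xs : List A) → T (allPairsᵇ r xs) → AllPairs (λ x y → T (r x y)) xs
allPairsᵇ-sound r [] _ = []
allPairsᵇ-sound r (x ∷ xs) t with Equivalence.to (T-∧ {all (r x) xs}) t
... | h , h' = all⁺ (r x) xs h ∷ allPairsᵇ-sound r xs h'

any-map : {A B : Set} (r : B → Bool) (h : A → B) (xs : List A) → any r (map h xs) ≡ any (r ∘ h) xs
any-map r h [] = refl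
any-map r h (x ∷ xs) = cong (r (h x) ∨_) (any-map r h xs)

nub-map : {A B : Set} (eq : B → B → Bool) (h : A → B) (xs : List A) →
          nub eq (map h xs) ≡ map h (nub (λ x y → eq (h x) (h y)) xs)
nub-map eq h [] = refl
nub-map eq h (x ∷ xs) rewrite any-map (eq (h x)) h xs | nub-map eq h xs with any (λ y → eq (h x) (h y)) xs
... | true = refl
... | false = refl

nub-distinct : {A : Set} (eq : A → A → Bool) (xs : List A) → AllPairs (λ x y → ¬ T (eq x y)) (nub eq xs)
nub-distinct eq [] = []
nub-distinct eq (x ∷ xs) with any (eq x) xs in found
... | true = nub-distinct eq xs
... | false = All.tabulate (λ y∈ t → subst T found (any⁺ (eq x) (lose (nub-⊆ eq xs y∈) t))) ∷ nub-distinct eq xs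

collide? : {A : Set} {R : A → A → Set} (g : A → ℕ) {xs : List A} → AllPairs R xs →
           AllPairs (λ x y → g x ≢ g y) xs ⊎ (∃₂ λ x y → x ∈ xs × y ∈ xs × R x y × g x ≡ g y)
collide? g [] = inj₁ []
collide? g {x ∷ xs} (r ∷ rs) with Any.any? (λ y → g x ≟ g y) xs | collide? g rs
... | yes some | _ with find some
...   | y , y∈ , eq = inj₂ (x , y , here refl , there y∈ , All.lookup r y∈ , eq)
collide? g (r ∷ rs) | no _ | inj₂ (y , z , y∈ , z∈ , h) = inj₂ (y , z , there y∈ , there z∈ , h)
collide? g (r ∷ rs) | no none | inj₁ d = inj₁ (All.tabulate (λ y∈ eq → none (lose y∈ eq)) ∷ d)

-- The keys of `ρ` and `ρ'` agree exactly when `side σ τ ρ ρ'` and `side σ τ ρ' ρ` have the same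
-- value, an equation between sums of monomials of degree 10.
side : Item → Item → Item → Item → List Mono
side σ τ ρ ρ' = (ws τ ⊗ us ρ ++ us σ ⊗ ws ρ) ++ (ws σ ⊗ us ρ' ++ us τ ⊗ ws ρ')

ev-side : ∀ p q σ τ ρ ρ' → let a , _ = key (values p q σ) (values p q τ) (values p q ρ)
                               _ , b = key (values p q σ) (values p q τ) (values p q ρ') in
          ev p q (side σ τ ρ ρ') ≡ a + b
ev-side p q σ τ ρ ρ' = trans (ev-++ p q (ws τ ⊗ us ρ ++ us σ ⊗ ws ρ) _)
  (cong₂ _+_ (both (ws τ) (us ρ) (us σ) (ws ρ)) (both (ws σ) (us ρ') (us τ) (ws ρ')))
  where
  both : ∀ A B C D → ev p q (A ⊗ B ++ C ⊗ D) ≡ ev p q A * ev p q B + ev p q C * ev p q D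
  both A B C D = trans (ev-++ p q (A ⊗ B) (C ⊗ D)) (cong₂ _+_ (ev-⊗ p q A B) (ev-⊗ p q C D))

kind : Item → Fin 3
kind (UU _ _) = sucF (sucF 0F)
kind (UW _ _) = sucF 0F
kind (WW _ _) = 0F

length-us : ∀ σ → length (us σ) ≡ toℕ (kind σ)
length-us (UU _ _) = refl
length-us (UW _ _) = refl
length-us (WW _ _) = refl

length-ws : ∀ σ → length (ws σ) ≡ 2 ∸ toℕ (kind σ)
length-ws (UU _ _) = refl
length-ws (UW _ _) = refl
length-ws (WW _ _) = refl

-- Each item has two monomials in all, so each half of `side` has at most `2 * 2`. This eight is the
-- source of the threshold `p ≥ 9`.
side≤8 : ∀ σ τ ρ ρ' → length (side σ τ ρ ρ') ≤ 8
side≤8 σ τ ρ ρ' rewrite length-++ (ws τ ⊗ us ρ ++ us σ ⊗ ws ρ) {ws σ ⊗ us ρ' ++ us τ ⊗ ws ρ'}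
  | length-++ (ws τ ⊗ us ρ) {us σ ⊗ ws ρ} | length-++ (ws σ ⊗ us ρ') {us τ ⊗ ws ρ'}
  | length-⊗ (ws τ) (us ρ) | length-⊗ (us σ) (ws ρ) | length-⊗ (ws σ) (us ρ') | length-⊗ (us τ) (ws ρ')
  | length-us σ | length-us τ | length-us ρ | length-us ρ'
  | length-ws σ | length-ws τ | length-ws ρ | length-ws ρ' = small (kind σ) (kind τ) (kind ρ) (kind ρ')
  where
  small : ∀ a b c d → (2 ∸ toℕ b) * toℕ c + toℕ a * (2 ∸ toℕ c) + ((2 ∸ toℕ a) * toℕ d + toℕ b * (2 ∸ toℕ d)) ≤ 8
  small = from-yes (all? {3} λ a → all? {3} λ b → all? {3} λ c → all? {3} λ d →
    (2 ∸ toℕ b) * toℕ c + toℕ a * (2 ∸ toℕ c) + ((2 ∸ toℕ a) * toℕ d + toℕ b * (2 ∸ toℕ d)) ≤? 8)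

item-homogeneous : ∀ σ → T (bounded σ) → Homogeneous 5 (us σ) × Homogeneous 5 (ws σ)
item-homogeneous (UU i j) t with Equivalence.to (T-∧ {i ≤ᵇ 5}) t
... | a , b = m+[n∸m]≡n (≤ᵇ⇒≤ i 5 a) ∷ m+[n∸m]≡n (≤ᵇ⇒≤ j 5 b) ∷ [] , []
item-homogeneous (UW i j) t with Equivalence.to (T-∧ {i ≤ᵇ 5}) t
... | a , b = m+[n∸m]≡n (≤ᵇ⇒≤ i 5 a) ∷ [] , m+[n∸m]≡n (≤ᵇ⇒≤ j 5 b) ∷ []
item-homogeneous (WW i j) t with Equivalence.to (T-∧ {i ≤ᵇ 5}) t
... | a , b = [] , m+[n∸m]≡n (≤ᵇ⇒≤ i 5 a) ∷ m+[n∸m]≡n (≤ᵇ⇒≤ j 5 b) ∷ []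

side-homogeneous : ∀ {σ τ ρ ρ'} → T (bounded σ) → T (bounded τ) → T (bounded ρ) → T (bounded ρ') →
                   Homogeneous 10 (side σ τ ρ ρ')
side-homogeneous {σ} {τ} {ρ} {ρ'} bσ bτ bρ bρ'
  with item-homogeneous σ bσ | item-homogeneous τ bτ | item-homogeneous ρ bρ | item-homogeneous ρ' bρ'
... | uσ , wσ | uτ , wτ | uρ , wρ | uρ' , wρ' = homogeneous-++
  (homogeneous-++ (homogeneous-⊗ wτ uρ) (homogeneous-⊗ uσ wρ))
  (homogeneous-++ (homogeneous-⊗ wσ uρ') (homogeneous-⊗ uτ wρ'))

-- It lets a computation at `(p' , q')` decide equations at `(p , q)`. It is used with both pairs
-- equal for `p ≤ 8` and with `(9 , 1)` as the second pair for `p ≥ 9`.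
Equivalent : (p q p' q' : ℕ) → Set
Equivalent p q p' q' = ∀ d {L R} → Homogeneous d L → Homogeneous d R → length L ≤ 8 → length R ≤ 8 →
  (ev p q L ≡ ev p q R → ev p' q' L ≡ ev p' q' R) × (ev p' q' L ≡ ev p' q' R → ev p q L ≡ ev p q R)

-- (uσ - uτ) (w - w') = (wσ - wτ) (u - u'), with the terms moved so that no subtraction occurs.
proportional : ∀ {X Y uσ wσ uτ wτ u w u' w'} → 1 ≤ X →
  X * uσ + Y * wσ ≡ X * uτ + Y * wτ → X * u + Y * w ≡ X * u' + Y * w' →
  (wτ * u + uσ * w) + (wσ * u' + uτ * w') ≡ (wτ * u' + uσ * w') + (wσ * u + uτ * w)
proportional {X} {Y} {uσ} {wσ} {uτ} {wτ} {u} {w} {u'} {w'} X≥1 S R =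
  *-cancelˡ X≥1 (+-cancelʳ-≡ (Y * ((wτ + wσ) * (w + w'))) _ _ (begin
    X * ((wτ * u + uσ * w) + (wσ * u' + uτ * w')) + Y * ((wτ + wσ) * (w + w'))
      ≡⟨ solve 10 (λ X Y uσ wσ uτ wτ u w u' w' →
           X :* ((wτ :* u :+ uσ :* w) :+ (wσ :* u' :+ uτ :* w')) :+ Y :* ((wτ :+ wσ) :* (w :+ w'))
           := wτ :* (X :* u :+ Y :* w) :+ w :* (X :* uσ :+ Y :* wσ) :+ (wσ :* (X :* u' :+ Y :* w') :+ w' :* (X :* uτ :+ Y :* wτ)))
           refl X Y uσ wσ uτ wτ u w u' w' ⟩
    wτ * (X * u + Y * w) + w * (X * uσ + Y * wσ) + (wσ * (X * u' + Y * w') + w' * (X * uτ + Y * wτ))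
      ≡⟨ cong₂ _+_ (cong₂ _+_ (cong (wτ *_) R) (cong (w *_) S)) (cong₂ _+_ (cong (wσ *_) (sym R)) (cong (w' *_) (sym S))) ⟩
    wτ * (X * u' + Y * w') + w * (X * uτ + Y * wτ) + (wσ * (X * u + Y * w) + w' * (X * uσ + Y * wσ))
      ≡⟨ solve 10 (λ X Y uσ wσ uτ wτ u w u' w' →
           wτ :* (X :* u' :+ Y :* w') :+ w :* (X :* uτ :+ Y :* wτ) :+ (wσ :* (X :* u :+ Y :* w) :+ w' :* (X :* uσ :+ Y :* wσ))
           := X :* ((wτ :* u' :+ uσ :* w') :+ (wσ :* u :+ uτ :* w)) :+ Y :* ((wτ :+ wσ) :* (w :+ w')))
           refl X Y uσ wσ uτ wτ u w u' w' ⟩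
    X * ((wτ * u' + uσ * w') + (wσ * u + uτ * w)) + Y * ((wτ + wσ) * (w + w')) ∎))
  where
  open ≡-Reasoning
  open +-*-Solver

-- The hypotheses are `X (uσ - uτ) = Y (wτ - wσ)` and `(uσ - uτ) b = (wτ - wσ) a`; eliminate
-- `wτ - wσ` and cancel `uσ - uτ > 0`.
ratio-determined : ∀ {X Y uσ wσ uτ wτ a b} → uτ < uσ →
  X * uσ + Y * wσ ≡ X * uτ + Y * wτ → uσ * b + wσ * a ≡ wτ * a + uτ * b → X * a ≡ Y * b
ratio-determined {X} {Y} {wσ = wσ} {uτ} {wτ} {a} {b} lt S C with m≤n⇒∃[o]m+o≡n lt
... | k , refl = *-cancelˡ {suc k} (s≤s z≤n) (+-cancelʳ-≡ (Y * (wσ * a)) _ _ (begin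
    suc k * (X * a) + Y * (wσ * a)    ≡⟨ solve 5 (λ d X a Y w → d :* (X :* a) :+ Y :* (w :* a) := (X :* d :+ Y :* w) :* a) refl (suc k) X a Y wσ ⟩
    (X * suc k + Y * wσ) * a          ≡⟨ cong (_* a) S' ⟩
    Y * wτ * a                        ≡⟨ *-assoc Y wτ a ⟩
    Y * (wτ * a)                      ≡⟨ cong (Y *_) C' ⟨
    Y * (suc k * b + wσ * a)          ≡⟨ solve 5 (λ Y d b w a → Y :* (d :* b :+ w :* a) := d :* (Y :* b) :+ Y :* (w :* a)) refl Y (suc k) b wσ a ⟩
    suc k * (Y * b) + Y * (wσ * a)    ∎))
  where
  open +-*-Solver
  open ≡-Reasoning
  S' : X * suc k + Y * wσ ≡ Y * wτ
  S' = +-cancelˡ-≡ (X * uτ) _ _ (trans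
    (solve 4 (λ X u k r → X :* u :+ (X :* (con 1 :+ k) :+ r) := X :* (con 1 :+ (u :+ k)) :+ r) refl X uτ k (Y * wσ)) S)
  C' : suc k * b + wσ * a ≡ wτ * a
  C' = +-cancelˡ-≡ (uτ * b) _ _ (trans
    (solve 4 (λ u k b r → u :* b :+ ((con 1 :+ k) :* b :+ r) := (con 1 :+ (u :+ k)) :* b :+ r) refl uτ k b (wσ * a))
    (trans C (+-comm (wτ * a) (uτ * b))))

module TwoRows {p q p' q' : ℕ} (equivalent : Equivalent p q p' q') {X Y : ℕ} (X≥1 : 1 ≤ X) (Y≥1 : 1 ≤ Y)
  (independent : ∀ e → e ≤ 5 → X * ev p q (power e ∷ []) ≢ Y * ev p q (power 0 ∷ [])
                             × X * ev p q (power 0 ∷ []) ≢ Y * ev p q (power e ∷ [])) where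

  value : Item → ℕ
  value σ = X * ev p q (us σ) + Y * ev p q (ws σ)

  private
    ratio : ∀ {σ τ a b} → ev p q (us σ) ≢ ev p q (us τ) → value σ ≡ value τ →
            ev p q (us σ) * b + ev p q (ws σ) * a ≡ ev p q (ws τ) * a + ev p q (us τ) * b → X * a ≡ Y * b
    ratio {σ} {τ} {a} {b} u≢ S C with <-cmp (ev p q (us σ)) (ev p q (us τ))
    ... | tri> _ _ gt = ratio-determined {X} {Y} {wσ = ev p q (ws σ)} {wτ = ev p q (ws τ)} {a} gt S C
    ... | tri≈ _ same _ = contradiction same u≢
    ... | tri< lt _ _ = ratio-determined {X} {Y} {wσ = ev p q (ws τ)} {wτ = ev p q (ws σ)} {a} lt (sym S) (trans (+-comm (ev p q (us τ) * b) _) (trans (sym C) (+-comm (ev p q (us σ) * b) _)))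

    not-commensurable : ∀ {σ τ i j} → T (bounded σ) → T (bounded τ) → i ≤ 5 → j ≤ 5 →
      value σ ≡ value τ → ev p q (us σ) ≢ ev p q (us τ) →
      X * ev p q (power i ∷ []) ≢ Y * ev p q (power j ∷ []) →
      ¬ T (commensurable (ev p' q' (power i ∷ [])) (ev p' q' (power j ∷ [])) (values p' q' σ) (values p' q' τ))
    not-commensurable {σ} {τ} {i} {j} bσ bτ i≤5 j≤5 S u≢ ne t = ne (ratio {σ} {τ} u≢ S
        (trans (sym (expand p q (us σ) [j] (ws σ) [i])) (trans (proj₂ (equivalent 10 hl hr ll lr)
          (trans (expand p' q' (us σ) [j] (ws σ) [i]) (trans (≡ᵇ⇒≡ _ _ t) (sym (expand p' q' (ws τ) [i] (us τ) [j])))))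
          (expand p q (ws τ) [i] (us τ) [j]))))
      where
      [i] = power i ∷ []
      [j] = power j ∷ []
      hom : ∀ {i} → i ≤ 5 → Homogeneous 5 (power i ∷ [])
      hom i≤5 = m+[n∸m]≡n i≤5 ∷ []
      expand : ∀ p q A B C D → ev p q (A ⊗ B ++ C ⊗ D) ≡ ev p q A * ev p q B + ev p q C * ev p q D
      expand p q A B C D = trans (ev-++ p q (A ⊗ B) (C ⊗ D)) (cong₂ _+_ (ev-⊗ p q A B) (ev-⊗ p q C D))
      hl : Homogeneous 10 (us σ ⊗ [j] ++ ws σ ⊗ [i])
      hl = homogeneous-++ (homogeneous-⊗ (proj₁ (item-homogeneous σ bσ)) (hom j≤5)) (homogeneous-⊗ (proj₂ (item-homogeneous σ bσ)) (hom i≤5))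
      hr : Homogeneous 10 (ws τ ⊗ [i] ++ us τ ⊗ [j])
      hr = homogeneous-++ (homogeneous-⊗ (proj₂ (item-homogeneous τ bτ)) (hom i≤5)) (homogeneous-⊗ (proj₁ (item-homogeneous τ bτ)) (hom j≤5))
      two≤8 : 2 ≤ 8
      two≤8 = s≤s (s≤s z≤n)
      ll : length (us σ ⊗ [j] ++ ws σ ⊗ [i]) ≤ 8
      ll = short σ
        where
        short : ∀ σ → length (us σ ⊗ [j] ++ ws σ ⊗ [i]) ≤ 8
        short (UU _ _) = two≤8
        short (UW _ _) = two≤8
        short (WW _ _) = two≤8
      lr : length (ws τ ⊗ [i] ++ us τ ⊗ [j]) ≤ 8
      lr = short τ
        where
        short : ∀ τ → length (ws τ ⊗ [i] ++ us τ ⊗ [j]) ≤ 8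
        short (UU _ _) = two≤8
        short (UW _ _) = two≤8
        short (WW _ _) = two≤8

    us≤8 : ∀ σ → length (us σ) ≤ 8
    us≤8 (UU _ _) = s≤s (s≤s z≤n)
    us≤8 (UW _ _) = s≤s z≤n
    us≤8 (WW _ _) = z≤n

    ws≤8 : ∀ σ → length (ws σ) ≤ 8
    ws≤8 (UU _ _) = z≤n
    ws≤8 (UW _ _) = s≤s z≤n
    ws≤8 (WW _ _) = s≤s (s≤s z≤n)

    u-equivalent : ∀ {σ τ} → T (bounded σ) → T (bounded τ) →
      (ev p q (us σ) ≡ ev p q (us τ) → ev p' q' (us σ) ≡ ev p' q' (us τ)) ×
      (ev p' q' (us σ) ≡ ev p' q' (us τ) → ev p q (us σ) ≡ ev p q (us τ))
    u-equivalent {σ} {τ} bσ bτ = equivalent 5 (proj₁ (item-homogeneous σ bσ)) (proj₁ (item-homogeneous τ bτ)) (us≤8 σ) (us≤8 τ)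

    w-equivalent : ∀ {σ τ} → T (bounded σ) → T (bounded τ) →
      (ev p q (ws σ) ≡ ev p q (ws τ) → ev p' q' (ws σ) ≡ ev p' q' (ws τ)) ×
      (ev p' q' (ws σ) ≡ ev p' q' (ws τ) → ev p q (ws σ) ≡ ev p q (ws τ))
    w-equivalent {σ} {τ} bσ bτ = equivalent 5 (proj₂ (item-homogeneous σ bσ)) (proj₂ (item-homogeneous τ bτ)) (ws≤8 σ) (ws≤8 τ)

    -- By `proportional`, equal sums have equal keys at `(p , q)`, and the equation of keys passes
    -- to `(p' , q')`; so keys that differ there belong to different sums.
    keys-distinct : ∀ {σ τ xs} → T (bounded σ) → T (bounded τ) → value σ ≡ value τ → All (T ∘ bounded) xs →
      AllPairs (λ ρ ρ' → ¬ T (eqKey (key (values p' q' σ) (values p' q' τ) (values p' q' ρ))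
                                    (key (values p' q' σ) (values p' q' τ) (values p' q' ρ')))) xs →
      AllPairs (λ ρ ρ' → value ρ ≢ value ρ') xs
    keys-distinct _ _ _ [] [] = []
    keys-distinct {σ} {τ} {ρ ∷ xs} bσ bτ S (bρ ∷ b) (d ∷ ds) =
      All.tabulate (λ {ρ'} ρ'∈ R → All.lookup d ρ'∈ (same ρ' (All.lookup b ρ'∈) R)) ∷ keys-distinct {σ} {τ} bσ bτ S b ds
      where
      same : ∀ ρ' → T (bounded ρ') → value ρ ≡ value ρ' → T (eqKey (key (values p' q' σ) (values p' q' τ) (values p' q' ρ))
                                                                   (key (values p' q' σ) (values p' q' τ) (values p' q' ρ')))
      same ρ' bρ' R = ≡⇒≡ᵇ _ _ (trans (sym (ev-side p' q' σ τ ρ ρ')) (trans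
        (proj₁ (equivalent 10 (side-homogeneous {σ} {τ} {ρ} {ρ'} bσ bτ bρ bρ') (side-homogeneous {σ} {τ} {ρ'} {ρ} bσ bτ bρ' bρ)
                  (side≤8 σ τ ρ ρ') (side≤8 σ τ ρ' ρ))
          (trans (ev-side p q σ τ ρ ρ') (trans
            (proportional {X} {Y} {ev p q (us σ)} {ev p q (ws σ)} {ev p q (us τ)} {ev p q (ws τ)}
              {ev p q (us ρ)} {ev p q (ws ρ)} {ev p q (us ρ')} {ev p q (ws ρ')} X≥1 S R)
            (sym (ev-side p q σ τ ρ' ρ)))))
        (ev-side p' q' σ τ ρ' ρ)))

    collision : ∀ N xs {σ τ} → All (T ∘ bounded) xs → T (bounded σ) → T (bounded τ) → value σ ≡ value τ →
      T (collision-ok N p' q' (map (values p' q') xs) (values p' q' σ) (values p' q' τ)) →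
      ∃ λ ys → ys ⊆ xs × AllPairs (λ ρ ρ' → value ρ ≢ value ρ') ys × N ≤ length ys
    collision N xs {σ} {τ} b bσ bτ S ok with ev p' q' (us σ) ≡ᵇ ev p' q' (us τ) in same-u
    ... | true = contradiction (≡⇒≡ᵇ _ _ (proj₁ (w-equivalent {σ} {τ} bσ bτ) w≡)) (T-not⇒¬T _ ok)
      where
      u≡ : ev p q (us σ) ≡ ev p q (us τ)
      u≡ = proj₂ (u-equivalent {σ} {τ} bσ bτ) (≡ᵇ⇒≡ _ _ (Equivalence.from T-≡ same-u))
      w≡ : ev p q (ws σ) ≡ ev p q (ws τ)
      w≡ = *-cancelˡ Y≥1 (+-cancelˡ-≡ (X * ev p q (us τ)) _ _ (subst (λ u → X * u + Y * ev p q (ws σ) ≡ value τ) u≡ S))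
    ... | false with ev p' q' (ws σ) ≡ᵇ ev p' q' (ws τ) in same-w
    ...   | true = contradiction (≡⇒≡ᵇ _ _ (proj₁ (u-equivalent {σ} {τ} bσ bτ) u≡)) (subst T same-u)
      where
      w≡ : ev p q (ws σ) ≡ ev p q (ws τ)
      w≡ = proj₂ (w-equivalent {σ} {τ} bσ bτ) (≡ᵇ⇒≡ _ _ (Equivalence.from T-≡ same-w))
      u≡ : ev p q (us σ) ≡ ev p q (us τ)
      u≡ = *-cancelˡ X≥1 (+-cancelʳ-≡ (Y * ev p q (ws τ)) _ _ (subst (λ w → X * ev p q (us σ) + Y * w ≡ value τ) w≡ S))
    ...   | false with Equivalence.to (T-∨ {dependent p' q' (values p' q' σ) (values p' q' τ)}) ok
    ...     | inj₂ many = ys , nub-⊆ r xs , keys-distinct {σ} {τ} bσ bτ S (All.tabulate (All.lookup b ∘ nub-⊆ r xs)) (nub-distinct r xs) ,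
        ≤-trans (≤ᵇ⇒≤ N _ many) (≤-reflexive same-length)
      where
      h : Item → ℕ × ℕ
      h = key (values p' q' σ) (values p' q' τ) ∘ values p' q'
      r : Item → Item → Bool
      r ρ ρ' = eqKey (h ρ) (h ρ')
      ys : List Item
      ys = nub r xs
      same-length : length (nub eqKey (map (key (values p' q' σ) (values p' q' τ)) (map (values p' q') xs))) ≡ length ys
      same-length = trans (cong (length ∘ nub eqKey) (sym (map-∘ xs))) (trans (cong length (nub-map eqKey h xs)) (length-map h ys))
    ...     | inj₁ dep with find (any⁻ _ (upTo 6) dep)
    ...       | e , e∈ , t = contradiction t ¬t
      where
      e≤5 : e ≤ 5
      e≤5 = s≤s⁻¹ (∈-upTo⁻ e∈)
      u≢ : ev p q (us σ) ≢ ev p q (us τ)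
      u≢ u≡ = subst T same-u (≡⇒≡ᵇ _ _ (proj₁ (u-equivalent {σ} {τ} bσ bτ) u≡))
      ¬t : ¬ T _
      ¬t t with Equivalence.to T-∨ t
      ... | inj₁ t₁ = not-commensurable {σ} {τ} bσ bτ e≤5 z≤n S u≢ (proj₁ (independent e e≤5)) t₁
      ... | inj₂ t₂ = not-commensurable {σ} {τ} bσ bτ z≤n e≤5 S u≢ (proj₂ (independent e e≤5)) t₂

  sum-count : ∀ s t N → check s t N p' q' ≡ true → ∀ {L : List ℕ} →
              (∀ {σ} → σ ∈ items s t → value σ ∈ L) → N ≤ length L
  sum-count s t N ok {L} contained with Equivalence.to (T-∧ {N ≤ᵇ length (items s t)}) (Equivalence.from T-≡ ok)
  ... | long , ok₁ with Equivalence.to (T-∧ {all bounded (items s t)}) ok₁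
  ... | bd , ok₂ = conclude (collide? value (AllPairsₚ.map⁻ (allPairsᵇ-sound _ (map (values p' q') (items s t)) ok₂)))
    where
    b : All (T ∘ bounded) (items s t)
    b = all⁺ bounded (items s t) bd
    count : ∀ {xs} → AllPairs (λ σ τ → value σ ≢ value τ) xs → xs ⊆ items s t → length xs ≤ length L
    count {xs} d sub = ≤-trans (≤-reflexive (sym (length-map value xs))) (length-⊆ (AllPairsₚ.map⁺ d) image⊆)
      where
      image⊆ : map value xs ⊆ L
      image⊆ z∈ with ∈-map⁻ value z∈
      ... | _ , σ∈ , refl = contained (sub σ∈)
    conclude : _ → N ≤ length L
    conclude (inj₁ distinct) = ≤-trans (≤ᵇ⇒≤ N _ long) (count distinct id)
    conclude (inj₂ (σ , τ , σ∈ , τ∈ , okστ , S))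
      with collision N (items s t) {σ} {τ} b (All.lookup b σ∈) (All.lookup b τ∈) S okστ
    ... | ys , sub , d , long' = ≤-trans long' (count d sub)

-- Evaluation over all ratios

allRatios : (ℕ → ℕ → Bool) → Bool
-- All `1 ≤ q < p ≤ 8`, in lowest terms or not, and `(9 , 1)` on behalf of every larger `p`.
allRatios r = r 9 1 ∧ all (λ p → all (λ q → r (2 + p) (1 + q)) (upTo (1 + p))) (upTo 7)

allRatios-nine : ∀ r → allRatios r ≡ true → r 9 1 ≡ true
allRatios-nine r ok = Equivalence.to T-≡ (proj₁ (Equivalence.to (T-∧ {r 9 1}) (Equivalence.from T-≡ ok)))

allRatios-small : ∀ r → allRatios r ≡ true → ∀ {p q} → 1 ≤ q → q < p → p < 9 → r p q ≡ true
allRatios-small r ok {suc zero} q≥1 (s≤s q≤0) _ = contradiction (≤-trans q≥1 q≤0) λ ()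
allRatios-small r ok {suc (suc p)} {suc q} _ (s≤s (s≤s q≤p)) p<9 = Equivalence.to T-≡
  (All.lookup (all⁺ (λ q → r (2 + p) (1 + q)) (upTo (1 + p))
    (All.lookup (all⁺ (λ p → all (λ q → r (2 + p) (1 + q)) (upTo (1 + p))) (upTo 7)
                      (proj₂ (Equivalence.to (T-∧ {r 9 1}) (Equivalence.from T-≡ ok))))
      (∈-upTo⁺ (+-cancelˡ-≤ 2 (suc p) 7 p<9))))
    (∈-upTo⁺ (s≤s q≤p)))

record Checked (s t N : ℕ) : Set where
  constructor checked
  field all-ratios : allRatios (check s t N) ≡ true

-- The targets are `25 = 3 * 9 - 2` and `22 = 3 * 8 - 2`. Rows of lengths 6 and 1, or 4 and 4, reach
-- 25 and serve both sizes; lengths 5 and 3 serve eight elements.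
check-6-1 : Checked 6 1 25
check-6-1 = checked refl

check-5-3 : Checked 5 3 22
check-5-3 = checked refl

check-4-4 : Checked 4 4 25
check-4-4 = checked refl

row-sums : ∀ s t N → Checked s t N → ∀ {p q X Y} → Coprime p q → 1 ≤ q → q < p → 1 ≤ X → 1 ≤ Y →
  (∀ e → e ≤ 5 → X * ev p q (power e ∷ []) ≢ Y * ev p q (power 0 ∷ []) × X * ev p q (power 0 ∷ []) ≢ Y * ev p q (power e ∷ [])) →
  ∀ {L} → (∀ {σ} → σ ∈ items s t → X * ev p q (us σ) + Y * ev p q (ws σ) ∈ L) → N ≤ length L
row-sums s t N (checked ok) {p} {q} cop q≥1 q<p X≥1 Y≥1 ind contained with 9 ≤? p
... | no p≱9 = TwoRows.sum-count {p} {q} {p} {q} (λ _ _ _ _ _ → id , id) X≥1 Y≥1 ind s t N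
        (allRatios-small (check s t N) ok q≥1 q<p (≰⇒> p≱9)) contained
... | yes p≥9 = TwoRows.sum-count {p} {q} {9} {1} transport X≥1 Y≥1 ind s t N (allRatios-nine (check s t N) ok) contained
  where
  transport : Equivalent p q 9 1
  transport d hl hr ll lr =
    (λ eq → homogeneous-identity cop p≥9 d hl hr ll lr eq 9 1) ,
    (λ eq → homogeneous-identity (λ (_ , d∣1) → ∣1⇒≡1 d∣1) ≤-refl d hl hr ll lr eq p q)

-- Recognising two progressions in an exponent list

infixl 7 _·_

_·_ : ℕ → Pt → Pt
n · (i , j , l) = n * i , n * j , n * l

onRow : List Pt → Pt → Pt → Pt → ℕ → Bool
onRow P y x u i = any (λ c → eqPt (c ⊕ i · x) (u ⊕ i · y)) P

-- `w` must not be a term `u + e (y - x)` or `u - e (y - x)` of the progression through `u`; for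
-- `e ≤ 5` this is the independence that excludes `dependent`.
separate : Pt → Pt → Pt → Pt → ℕ → Bool
separate y x u w e = not (eqPt (u ⊕ e · y) (w ⊕ e · x)) ∧ not (eqPt (u ⊕ e · x) (w ⊕ e · y))

secondRow : ℕ → List Pt → Pt → Pt → Pt → Pt → Bool
secondRow t P y x u w = all (onRow P y x w) (upTo t) ∧ all (separate y x u w) (upTo 6)

bothRows : ℕ → ℕ → List Pt → Pt → Pt → Pt → Bool
bothRows s t P y x u = all (onRow P y x u) (upTo s) ∧ any (secondRow t P y x u) P

-- P contains s points u, u + (y - x), u + 2 (y - x), … and t points w, w + (y - x), …
rows : ℕ → ℕ → List Pt → Bool
rows s t P = any (λ (y , x) → any (bothRows s t P y x) P) (orderedPairs P)

rows-sound : ∀ s t P → T (rows s t P) → ∃₂ λ y x → (y , x) ∈ orderedPairs P × ∃₂ λ u w → u ∈ P × w ∈ P ×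
  (∀ {i} → i < s → T (onRow P y x u i)) × (∀ {i} → i < t → T (onRow P y x w i)) × (∀ {e} → e ≤ 5 → T (separate y x u w e))
rows-sound s t P has with find (any⁻ (λ (y , x) → any (bothRows s t P y x) P) (orderedPairs P) has)
... | (y , x) , yx∈ , h with find (any⁻ (bothRows s t P y x) P h)
... | u , u∈ , h₁ with Equivalence.to (T-∧ {all (onRow P y x u) (upTo s)}) h₁
... | row-u , h₂ with find (any⁻ (secondRow t P y x u) P h₂)
... | w , w∈ , h₃ with Equivalence.to (T-∧ {all (onRow P y x w) (upTo t)}) h₃
... | row-w , sep = y , x , yx∈ , u , w , u∈ , w∈ ,
  (λ i< → All.lookup (all⁺ (onRow P y x u) (upTo s) row-u) (∈-upTo⁺ i<)) ,
  (λ i< → All.lookup (all⁺ (onRow P y x w) (upTo t) row-w) (∈-upTo⁺ i<)) ,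
  (λ e≤ → All.lookup (all⁺ (separate y x u w) (upTo 6) sep) (∈-upTo⁺ (s≤s e≤)))

rows₈ rows₉ : List Pt → Bool
rows₈ P = rows 6 1 P ∨ (rows 5 3 P ∨ rows 4 4 P)
rows₉ P = rows 6 1 P ∨ rows 4 4 P

-- Obtained by evaluating the search. The rows need not exhaust the set, since a subset with enough
-- sums suffices.
reach₈-rows : all rows₈ (reach 5) ≡ true
reach₈-rows = refl

reach₉-rows : all rows₉ (reach 6) ≡ true
reach₉-rows = refl

all-lookup : {A : Set} (r : A → Bool) (xs : List A) → all r xs ≡ true → ∀ {x} → x ∈ xs → T (r x)
all-lookup r xs ok = All.lookup (all⁺ r xs (Equivalence.from T-≡ ok))

data Indices (s t : ℕ) : Item → Set where
  UU : ∀ {i j} → i < s → j < s → Indices s t (UU i j)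
  UW : ∀ {i j} → i < s → j < t → Indices s t (UW i j)
  WW : ∀ {i j} → i < t → j < t → Indices s t (WW i j)

triangular-sound : ∀ c s {σ} → σ ∈ triangular c s → ∃₂ λ i j → i < s × j < s × σ ≡ c i j
triangular-sound c s σ∈ with find (∈-concatMap⁻ _ {xs = upTo s} σ∈)
... | j , j∈ , m with ∈-map⁻ (λ i → c i j) m
... | i , i∈ , eq = i , j , <-≤-trans (∈-upTo⁻ i∈) (∈-upTo⁻ j∈) , ∈-upTo⁻ j∈ , eq

items-sound : ∀ s t {σ} → σ ∈ items s t → Indices s t σ
items-sound s t σ∈ with ∈-++⁻ (triangular UU s) σ∈
... | inj₁ m with triangular-sound UU s m
...   | _ , _ , i< , j< , refl = UU i< j<
items-sound s t σ∈ | inj₂ m with ∈-++⁻ (cartesianProductWith UW (upTo s) (upTo t)) m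
... | inj₁ m' with ∈-cartesianProductWith⁻ UW (upTo s) (upTo t) m'
...   | _ , _ , i∈ , j∈ , refl = UW (∈-upTo⁻ i∈) (∈-upTo⁻ j∈)
items-sound s t σ∈ | inj₂ m | inj₂ m' with triangular-sound WW t m'
... | _ , _ , i< , j< , refl = WW i< j<

orderedPairs-sound : ∀ {Z : List (ℕ × Pt)} → AllPairs _≻_ Z → ∀ {cy cx} → (cy , cx) ∈ orderedPairs (map proj₂ Z) →
  ∃₂ λ y x → (y , cy) ∈ Z × (x , cx) ∈ Z × x < y
orderedPairs-sound {h ∷ Z} (h> ∷ desc) m with ∈-++⁻ (map (proj₂ h ,_) (map proj₂ Z)) m
... | inj₂ m' with orderedPairs-sound desc m'
...   | y , x , y∈ , x∈ , lt = y , x , there y∈ , there x∈ , lt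
orderedPairs-sound {h ∷ Z} (h> ∷ desc) m | inj₁ m' with ∈-map⁻ (proj₂ h ,_) m'
... | cx , cx∈ , refl with ∈-map⁻ proj₂ cx∈
... | (x , _) , x∈ , refl = proj₁ h , x , here refl , there x∈ , All.lookup h> x∈

-- Sums of the sets found by the search

module TightSums (f : ℕ → ℕ) (f-* : ∀ {x y} → 1 ≤ x → 1 ≤ y → f (x * y) ≡ f x + f y)
                 {a₀ a₁ : ℕ} (a₀≥1 : 1 ≤ a₀) (a₀<a₁ : a₀ < a₁) (f-sep : f a₀ ≢ f a₁) where

  open Line f f-* a₀≥1 a₀<a₁ f-sep
  open ProductSet f f-* a₀≥1 a₀<a₁ f-sep

  module _ {A : List ℕ} (desc : AllPairs _>_ A) (pos : All (1 ≤_) A) (tight-A : Tight A) (small : Tight.k tight-A ≤ 6) where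

    open Tight tight-A
    P = map proj₂ Z

    Φₚ-· : ∀ n c → Φₚ (n · c) ≡ Φₚ c ^ n
    Φₚ-· n (i , j , l) = trans (cong₂ _*_ (cong₂ _*_ (flip a₀ i) (flip a₁ j)) (flip γ l))
      (sym (trans (^-distribʳ-* (a₀ ^ i * a₁ ^ j) (γ ^ l) n) (cong (_* (γ ^ l) ^ n) (^-distribʳ-* (a₀ ^ i) (a₁ ^ j) n))))
      where
      flip : ∀ a i → a ^ (n * i) ≡ (a ^ i) ^ n
      flip a i = trans (cong (a ^_) (*-comm n i)) (sym (^-*-assoc a i n))

    rep-power : ∀ {a c x cx} n → Rep (a , c) → Rep (x , cx) → D * D ^ n * (a * x ^ n) ≡ Φₚ (c ⊕ n · cx)
    rep-power {a} {c} {x} {cx} n ra rx = begin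
      D * D ^ n * (a * x ^ n)      ≡⟨ solve 4 (λ d e a y → d :* e :* (a :* y) := d :* a :* (e :* y)) refl D (D ^ n) a (x ^ n) ⟩
      D * a * (D ^ n * x ^ n)      ≡⟨ cong₂ _*_ (scaled ra) (sym (^-distribʳ-* D x n)) ⟩
      Φₚ c * (D * x) ^ n           ≡⟨ cong (λ k → Φₚ c * k ^ n) (scaled rx) ⟩
      Φₚ c * Φₚ cx ^ n             ≡⟨ cong (Φₚ c *_) (Φₚ-· n cx) ⟨
      Φₚ c * Φₚ (n · cx)           ≡⟨ Φₚ-⊕ c (n · cx) ⟩
      Φₚ (c ⊕ n · cx)              ∎
      where
      open ≡-Reasoning
      open +-*-Solver

    degree-· : ∀ n c → degree (n · c) ≡ n * degree c
    degree-· n (i , j , l) = solve 4 (λ n i j l → n :* i :+ n :* j :+ n :* l := n :* (i :+ j :+ l)) refl n i j l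
      where
      open +-*-Solver

    deg : ∀ {p} → p ∈ Z → degree (proj₂ p) ≡ 61
    deg p∈ = Boxed.deg (reach-boxed small points (∈-map⁺ proj₂ p∈))

    same-degree : ∀ {b c d e} n → b ∈ Z → c ∈ Z → d ∈ Z → e ∈ Z →
                  degree (proj₂ b ⊕ n · proj₂ c) ≡ degree (proj₂ d ⊕ n · proj₂ e)
    same-degree {_ , b} {_ , c} {_ , d} {_ , e} n b∈ c∈ d∈ e∈ =
      trans (expand b c) (trans (cong₂ (λ i j → i + n * j) (trans (deg b∈) (sym (deg d∈))) (trans (deg c∈) (sym (deg e∈)))) (sym (expand d e)))
      where
      expand : ∀ b c → degree (b ⊕ n · c) ≡ degree b + n * degree c
      expand b c = trans (degree-⊕ b (n · c)) (cong (degree b +_) (degree-· n c))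

    point : ∀ {c} → c ∈ P → ∃ λ a → (a , c) ∈ Z
    point c∈ with ∈-map⁻ proj₂ c∈
    ... | (a , _) , a∈ , refl = a , a∈

    element : ∀ {p} → p ∈ Z → proj₁ p ∈ A
    element p∈ = subst (_ ∈_) elements (∈-map⁺ proj₁ p∈)

    positive : ∀ {p} → p ∈ Z → 1 ≤ proj₁ p
    positive p∈ = All.lookup pos (element p∈)

    Z-desc : AllPairs _≻_ Z
    Z-desc = AllPairsₚ.map⁻ (subst (AllPairs _>_) (sym elements) desc)

    module _ {s t : ℕ} (s≤6 : s ≤ 6) (t≤6 : t ≤ 6) {y x u w : ℕ} {cy cx cu cw : Pt}
             (y∈ : (y , cy) ∈ Z) (x∈ : (x , cx) ∈ Z) (u∈ : (u , cu) ∈ Z) (w∈ : (w , cw) ∈ Z) (x<y : x < y)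
             (row-u : ∀ {i} → i < s → T (onRow P cy cx cu i)) (row-w : ∀ {i} → i < t → T (onRow P cy cx cw i))
             (sep : ∀ {e} → e ≤ 5 → T (separate cy cx cu cw e))
             {g p q : ℕ} (g≥1 : 1 ≤ g) (y≡ : y ≡ g * p) (x≡ : x ≡ g * q) where

      open +-*-Solver
      open ≡-Reasoning

      q≥1 : 1 ≤ q
      q≥1 = n≢0⇒n>0 λ { refl → <⇒≢ (positive x∈) (sym (trans x≡ (*-zeroʳ g))) }
      q<p : q < p
      q<p = *-cancelˡ-< g q p (subst₂ _<_ x≡ y≡ x<y)

      ratio : ∀ n {a b} → a * x ^ n ≡ b * y ^ n → a * q ^ n ≡ b * p ^ n
      ratio n {a} {b} eq = *-cancelˡ (^-pos n g≥1) (begin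
        g ^ n * (a * q ^ n)   ≡⟨ solve 3 (λ g a q → g :* (a :* q) := a :* (g :* q)) refl (g ^ n) a (q ^ n) ⟩
        a * (g ^ n * q ^ n)   ≡⟨ cong (a *_) (^-distribʳ-* g q n) ⟨
        a * (g * q) ^ n       ≡⟨ cong (λ k → a * k ^ n) x≡ ⟨
        a * x ^ n             ≡⟨ eq ⟩
        b * y ^ n             ≡⟨ cong (λ k → b * k ^ n) y≡ ⟩
        b * (g * p) ^ n       ≡⟨ cong (b *_) (^-distribʳ-* g p n) ⟩
        b * (g ^ n * p ^ n)   ≡⟨ solve 3 (λ g a q → a :* (g :* q) := g :* (a :* q)) refl (g ^ n) b (p ^ n) ⟩
        g ^ n * (b * p ^ n)   ∎)

      unratio : ∀ n {a b} → a * p ^ n ≡ b * q ^ n → a * y ^ n ≡ b * x ^ n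
      unratio n {a} {b} eq = begin
        a * y ^ n             ≡⟨ cong (λ k → a * k ^ n) y≡ ⟩
        a * (g * p) ^ n       ≡⟨ cong (a *_) (^-distribʳ-* g p n) ⟩
        a * (g ^ n * p ^ n)   ≡⟨ solve 3 (λ g a q → a :* (g :* q) := g :* (a :* q)) refl (g ^ n) a (p ^ n) ⟩
        g ^ n * (a * p ^ n)   ≡⟨ cong (g ^ n *_) eq ⟩
        g ^ n * (b * q ^ n)   ≡⟨ solve 3 (λ g a q → g :* (a :* q) := a :* (g :* q)) refl (g ^ n) b (q ^ n) ⟩
        b * (g ^ n * q ^ n)   ≡⟨ cong (b *_) (^-distribʳ-* g q n) ⟨
        b * (g * q) ^ n       ≡⟨ cong (λ k → b * k ^ n) x≡ ⟨
        b * x ^ n             ∎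

      -- The element `a` is `v (p / q) ^ i`, where `p / q` is `y / x` in lowest terms.
      record RowElement (v i : ℕ) : Set where
        constructor rowElement
        field
          {a} : ℕ
          a∈ : a ∈ A
          a≡ : q ^ 5 * a ≡ v * evMono p q (power i)

      on-row : ∀ {m cv v} → (v , cv) ∈ Z → m ≤ 6 → (∀ {i} → i < m → T (onRow P cy cx cv i)) → ∀ {i} → i < m →
               RowElement v i
      on-row {m} {cv} {v} v∈ m≤6 row {i} i<m with find (any⁻ (λ c → eqPt (c ⊕ i · cx) (cv ⊕ i · cy)) P (row i<m))
      ... | c , c∈ , eq with point c∈
      ... | a , a∈ = rowElement (element a∈) (begin
        q ^ 5 * a                       ≡⟨ cong (λ k → q ^ k * a) (m+[n∸m]≡n i≤5) ⟨
        q ^ (i + (5 ∸ i)) * a           ≡⟨ cong (_* a) (^-distribˡ-+-* q i (5 ∸ i)) ⟩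
        q ^ i * q ^ (5 ∸ i) * a         ≡⟨ solve 3 (λ r s a → r :* s :* a := a :* r :* s) refl (q ^ i) (q ^ (5 ∸ i)) a ⟩
        a * q ^ i * q ^ (5 ∸ i)         ≡⟨ cong (_* q ^ (5 ∸ i)) (ratio i {a} {v} a-eq) ⟩
        v * p ^ i * q ^ (5 ∸ i)         ≡⟨ *-assoc v (p ^ i) (q ^ (5 ∸ i)) ⟩
        v * (p ^ i * q ^ (5 ∸ i))       ∎)
        where
        i≤5 : i ≤ 5
        i≤5 = s≤s⁻¹ (≤-trans i<m m≤6)
        a-eq : a * x ^ i ≡ v * y ^ i
        a-eq = *-cancelˡ (*-pos D-pos (^-pos i D-pos)) (trans (rep-power i (All.lookup reps a∈) (All.lookup reps x∈))
          (trans (cong Φₚ (eqPt-sound {c ⊕ i · cx} eq)) (sym (rep-power i (All.lookup reps v∈) (All.lookup reps y∈)))))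

      separated : ∀ e {b c d z} → b ∈ Z → c ∈ Z → d ∈ Z → z ∈ Z →
                  T (not (eqPt (proj₂ b ⊕ e · proj₂ c) (proj₂ d ⊕ e · proj₂ z))) → proj₁ b * proj₁ c ^ e ≢ proj₁ d * proj₁ z ^ e
      separated e {b} {c} {d} {z} b∈ c∈ d∈ z∈ t eq = T-not⇒¬T _ t (subst (λ k → T (eqPt (proj₂ b ⊕ e · proj₂ c) k))
        (Φₚ-injective (same-degree e b∈ c∈ d∈ z∈) (trans (sym (rep-power e (All.lookup reps b∈) (All.lookup reps c∈)))
          (trans (cong (D * D ^ e *_) eq) (rep-power e (All.lookup reps d∈) (All.lookup reps z∈)))))
        (eqPt-refl (proj₂ b ⊕ e · proj₂ c)))

      independent : ∀ e → e ≤ 5 → u * ev p q (power e ∷ []) ≢ w * ev p q (power 0 ∷ [])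
                                × u * ev p q (power 0 ∷ []) ≢ w * ev p q (power e ∷ [])
      independent e e≤5 with Equivalence.to (T-∧ {not (eqPt (cu ⊕ e · cy) (cw ⊕ e · cx))}) (sep e≤5)
      ... | s₁ , s₂ =
        (λ eq → separated e u∈ y∈ w∈ x∈ s₁ (unratio e {u} {w} (cancelled {u} {w} eq))) ,
        (λ eq → separated e u∈ x∈ w∈ y∈ s₂ (sym (unratio e {w} {u} (cancelled {w} {u} (sym eq)))))
        where
        q^5 : q ^ 5 ≡ q ^ e * q ^ (5 ∸ e)
        q^5 = trans (cong (q ^_) (sym (m+[n∸m]≡n e≤5))) (^-distribˡ-+-* q e (5 ∸ e))
        cancelled : ∀ {a b} → a * ev p q (power e ∷ []) ≡ b * ev p q (power 0 ∷ []) → a * p ^ e ≡ b * q ^ e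
        cancelled {a} {b} eq = *-cancelˡ (^-pos (5 ∸ e) q≥1) (begin
          q ^ (5 ∸ e) * (a * p ^ e)              ≡⟨ solve 3 (λ r a s → r :* (a :* s) := a :* (s :* r :+ con 0)) refl (q ^ (5 ∸ e)) a (p ^ e) ⟩
          a * (p ^ e * q ^ (5 ∸ e) + 0)          ≡⟨ eq ⟩
          b * (1 * q ^ 5 + 0)                    ≡⟨ cong (λ k → b * (1 * k + 0)) q^5 ⟩
          b * (1 * (q ^ e * q ^ (5 ∸ e)) + 0)    ≡⟨ solve 3 (λ r b s → b :* (con 1 :* (s :* r) :+ con 0) := r :* (b :* s)) refl (q ^ (5 ∸ e)) b (q ^ e) ⟩
          q ^ (5 ∸ e) * (b * q ^ e)              ∎)

      scaled-sum : ∀ {v v' i j k} → RowElement v i → RowElement v' j →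
        v * evMono p q (power i) + v' * evMono p q (power j) ≡ k → k ∈ map (q ^ 5 *_) (deduplicate _≟_ (sumList A))
      scaled-sum (rowElement {a} a∈ a≡) (rowElement {b} b∈ b≡) eq =
        subst (_∈ map (q ^ 5 *_) (deduplicate _≟_ (sumList A)))
          (trans (*-distribˡ-+ (q ^ 5) a b) (trans (cong₂ _+_ a≡ b≡) eq))
          (∈-map⁺ (q ^ 5 *_) (∈-deduplicate⁺ _≟_ (Growth.∈-square⁺ _+_ a∈ b∈)))

      contained : ∀ {σ} → Indices s t σ → u * ev p q (us σ) + w * ev p q (ws σ) ∈ map (q ^ 5 *_) (deduplicate _≟_ (sumList A))
      contained (UU {i} {j} i< j<) = scaled-sum (on-row u∈ s≤6 row-u i<) (on-row u∈ s≤6 row-u j<)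
        (solve 4 (λ u w m n → u :* m :+ u :* n := u :* (m :+ (n :+ con 0)) :+ w :* con 0) refl u w (evMono p q (power i)) (evMono p q (power j)))
      contained (UW {i} {j} i< j<) = scaled-sum (on-row u∈ s≤6 row-u i<) (on-row w∈ t≤6 row-w j<)
        (solve 4 (λ u w m n → u :* m :+ w :* n := u :* (m :+ con 0) :+ w :* (n :+ con 0)) refl u w (evMono p q (power i)) (evMono p q (power j)))
      contained (WW {i} {j} i< j<) = scaled-sum (on-row w∈ t≤6 row-w i<) (on-row w∈ t≤6 row-w j<)
        (solve 4 (λ u w m n → w :* m :+ w :* n := u :* con 0 :+ w :* (m :+ (n :+ con 0))) refl u w (evMono p q (power i)) (evMono p q (power j)))

      two-row-sums : ∀ {N} → Coprime p q → Checked s t N → N ≤ card (sumList A)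
      two-row-sums {N} cop ok = subst (N ≤_) (length-map (q ^ 5 *_) (deduplicate _≟_ (sumList A)))
        (row-sums s t N ok cop q≥1 q<p (positive u∈) (positive w∈) independent
          {map (q ^ 5 *_) (deduplicate _≟_ (sumList A))} λ σ∈ → contained (items-sound s t σ∈))

    tight-sums : ∀ s t N → s ≤ 6 → t ≤ 6 → Checked s t N → T (rows s t P) → N ≤ card (sumList A)
    tight-sums s t N s≤6 t≤6 ok has-rows =
      let cy , cx , yx∈ , cu , cw , cu∈ , cw∈ , row-u , row-w , sep = rows-sound s t P has-rows
          y , x , y∈ , x∈ , x<y = orderedPairs-sound Z-desc yx∈
          u , u∈ = point cu∈
          w , w∈ = point cw∈
          g , p , q , g≥1 , y≡ , x≡ , cop = lowest-terms (positive y∈) (positive x∈)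
      in two-row-sums {s} {t} s≤6 t≤6 {y} {x} {u} {w} {cy} {cx} {cu} {cw} y∈ x∈ u∈ w∈ x<y
           (λ {i} → row-u {i}) (λ {i} → row-w {i}) (λ {e} → sep {e}) {g} {p} {q} g≥1 y≡ x≡ cop ok

-- The minimum

sorted : ∀ {A} → IsPosSet A → ∃ λ B → B ↭ A × AllPairs _>_ B × All (1 ≤_) B
sorted {A} (unique , pos) = sort A , sort-↭ A ,
  strict (Linked⇒AllPairs (λ p q → ≤-trans q p) (sort-↗ A))
         (PermutationSetoid.Unique-resp-↭ (↭⇒↭ₛ (↭-sym (sort-↭ A))) unique) ,
  All-resp-↭ (↭-sym (sort-↭ A)) pos
  where
  strict : ∀ {B} → AllPairs _≥_ B → Unique B → AllPairs _>_ B
  strict [] [] = []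
  strict (p ∷ ps) (q ∷ qs) = All.zipWith (λ (x≥y , x≢y) → ≤∧≢⇒< x≥y (x≢y ∘ sym)) (p , q) ∷ strict ps qs

last-two : (A : List ℕ) → 2 ≤ length A → ∃ λ pre → ∃₂ λ a b → A ≡ pre ++ a ∷ b ∷ []
last-two (_ ∷ []) (s≤s ())
last-two (a ∷ b ∷ []) _ = [] , a , b , refl
last-two (a ∷ A@(_ ∷ _ ∷ _)) _ with last-two A (s≤s (s≤s z≤n))
... | pre , b , c , eq = a ∷ pre , b , c , cong (a ∷_) eq

AllPairs-suffix : ∀ pre {A} → AllPairs _>_ (pre ++ A) → AllPairs _>_ A
AllPairs-suffix [] d = d
AllPairs-suffix (_ ∷ pre) (_ ∷ d) = AllPairs-suffix pre d

cost-mono : ∀ {A B} → B ⊆ A → spCost B ≤ spCost A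
cost-mono {A} {B} sub = ⊔-mono-≤ (card-mono (Growth.square-⊆ _+_ {B} {A} sub)) (card-mono (Growth.square-⊆ _*_ {B} {A} sub))

record LowerBounds (A : List ℕ) : Set where
  field
    weak : 3 * length A ≤ 3 + spCost A
    strong : 8 ≤ length A → 3 * length A ≤ 2 + spCost A

-- The gap between `n (n + 1) / 2` and `3 n - 3` is `(n - 2) (n - 3) / 2`; both bounds are evaluated
-- for `n ≤ 9`.
triangle-bound : ∀ n → 2 ≤ n → n ≤ 9 → 3 * n ≤ 3 + triangle n × (8 ≤ n → 3 * n ≤ 2 + triangle n)
triangle-bound n n≥2 n≤9 = All.lookup
  (from-yes (All.all? (λ n → (2 ≤? n) →-dec ((3 * n ≤? 3 + triangle n) ×-dec ((8 ≤? n) →-dec (3 * n ≤? 2 + triangle n)))) (upTo 10)))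
  (∈-upTo⁺ (s≤s n≤9)) n≥2

lower-bounds : ∀ {A} → AllPairs _>_ A → All (1 ≤_) A → 2 ≤ length A → length A ≤ 9 → LowerBounds A
lower-bounds {A} desc pos n≥2 n≤9 with last-two A n≥2
... | pre , a₁ , a₀ , refl with AllPairs-suffix pre desc
... | (a₀<a₁ ∷ []) ∷ _ = conclude (classify pre desc pos n≤9)
  where
  a₀≥1 : 1 ≤ a₀
  a₀≥1 = All.lookup pos (∈-++⁺ʳ pre (there (here refl)))

  ℓ-prime = proj₁ (proj₂ (separating-prime a₀≥1 a₀<a₁))
  sep = proj₂ (proj₂ (separating-prime a₀≥1 a₀<a₁))

  open Valuation ℓ-prime
  open LineSums ℓ-prime a₀≥1 a₀<a₁ sep using (line-sums)
  open ProductSet v v-* a₀≥1 a₀<a₁ sep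
  open TightSums v v-* a₀≥1 a₀<a₁ sep using (tight-sums)

  n = length A
  sums≤ = m≤m⊔n (card (sumList A)) (card (prodList A))
  products≤ = m≤n⊔m (card (sumList A)) (card (prodList A))

  tight-bound : (t : Tight A) → 8 ≤ n → 3 * n ≤ 2 + card (sumList A)
  tight-bound t n≥8 = by-size (Tight.k t) refl (subst (8 ≤_) (Tight.size t) n≥8) (subst (_≤ 9) (Tight.size t) n≤9)
    where
    P = map proj₂ (Tight.Z t)
    bound : Tight.k t ≤ 6 → ∀ r c N → r ≤ 6 → c ≤ 6 → Checked r c N → T (rows r c P) → N ≤ card (sumList A)
    bound = tight-sums desc pos t
    pick₈ : Tight.k t ≤ 6 → T (rows₈ P) → 22 ≤ card (sumList A)
    pick₈ k≤6 h = [ (λ r → ≤-trans (m≤m+n 22 3) (bound k≤6 6 1 25 ≤-refl (m≤m+n 1 5) check-6-1 r)) ,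
      (λ h' → [ bound k≤6 5 3 22 (m≤m+n 5 1) (m≤m+n 3 3) check-5-3 ,
                (λ r → ≤-trans (m≤m+n 22 3) (bound k≤6 4 4 25 (m≤m+n 4 2) (m≤m+n 4 2) check-4-4 r)) ]′
              (Equivalence.to (T-∨ {rows 5 3 P}) h')) ]′ (Equivalence.to (T-∨ {rows 6 1 P}) h)
    pick₉ : Tight.k t ≤ 6 → T (rows₉ P) → 25 ≤ card (sumList A)
    pick₉ k≤6 h = [ bound k≤6 6 1 25 ≤-refl (m≤m+n 1 5) check-6-1 ,
                    bound k≤6 4 4 25 (m≤m+n 4 2) (m≤m+n 4 2) check-4-4 ]′ (Equivalence.to (T-∨ {rows 6 1 P}) h)
    -- The search starts with three elements, so sizes 8 and 9 are `k = 5` and `k = 6`; and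
    -- `3 * 8 = 2 + 22`, `3 * 9 = 2 + 25`.
    by-size : ∀ k → Tight.k t ≡ k → 8 ≤ 3 + k → 3 + k ≤ 9 → 3 * n ≤ 2 + card (sumList A)
    by-size 5 k≡ _ _ = subst (λ m → 3 * m ≤ 2 + card (sumList A)) (sym (trans (Tight.size t) (cong (3 +_) k≡)))
      (+-monoʳ-≤ 2 {22} (pick₈ (≤-trans (≤-reflexive k≡) (n≤1+n 5))
        (all-lookup rows₈ (reach 5) reach₈-rows (subst (λ k → P ∈ reach k) k≡ (Tight.points t)))))
    by-size 6 k≡ _ _ = subst (λ m → 3 * m ≤ 2 + card (sumList A)) (sym (trans (Tight.size t) (cong (3 +_) k≡)))
      (+-monoʳ-≤ 2 {25} (pick₉ (≤-reflexive k≡)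
        (all-lookup rows₉ (reach 6) reach₉-rows (subst (λ k → P ∈ reach k) k≡ (Tight.points t)))))
    by-size 0 _ (s≤s (s≤s (s≤s ()))) _
    by-size 1 _ (s≤s (s≤s (s≤s (s≤s ())))) _
    by-size 2 _ (s≤s (s≤s (s≤s (s≤s (s≤s ()))))) _
    by-size 3 _ (s≤s (s≤s (s≤s (s≤s (s≤s (s≤s ())))))) _
    by-size 4 _ (s≤s (s≤s (s≤s (s≤s (s≤s (s≤s (s≤s ()))))))) _
    by-size (suc (suc (suc (suc (suc (suc (suc _))))))) _ _ (s≤s (s≤s (s≤s (s≤s (s≤s (s≤s (s≤s (s≤s (s≤s ())))))))))

  conclude : Outcome A → LowerBounds A
  conclude (line on) = record
    { weak = ≤-trans (proj₁ (triangle-bound n n≥2 n≤9)) (+-monoʳ-≤ 3 many)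
    ; strong = λ n≥8 → ≤-trans (proj₂ (triangle-bound n n≥2 n≤9) n≥8) (+-monoʳ-≤ 2 many) }
    where
    many : triangle n ≤ spCost A
    many = ≤-trans (line-sums desc pos on) sums≤
  conclude (big b) = record
    { weak = ≤-trans b (≤-trans (n≤1+n _) (+-monoʳ-≤ 3 products≤))
    ; strong = λ _ → ≤-trans b (+-monoʳ-≤ 2 products≤) }
  conclude (tight b t) = record
    { weak = ≤-trans b (+-monoʳ-≤ 3 products≤)
    ; strong = λ n≥8 → ≤-trans (tight-bound t n≥8) (+-monoʳ-≤ 2 sums≤) }

cost-bounds : ∀ A → IsPosSet A → 2 ≤ length A → length A ≤ 9 →
              3 * length A ≤ 3 + spCost A × (8 ≤ length A → 3 * length A ≤ 2 + spCost A)
cost-bounds A pos-set n≥2 n≤9 with sorted pos-set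
... | B , B↭A , desc , pos = transfer (↭-length B↭A)
  where
  transfer : length B ≡ length A → 3 * length A ≤ 3 + spCost A × (8 ≤ length A → 3 * length A ≤ 2 + spCost A)
  transfer len = ≤-trans (≤-reflexive (cong (3 *_) (sym len))) (≤-trans (LowerBounds.weak lb) (+-monoʳ-≤ 3 cost≤)) ,
    λ n≥8 → ≤-trans (≤-reflexive (cong (3 *_) (sym len))) (≤-trans (LowerBounds.strong lb (subst (8 ≤_) (sym len) n≥8)) (+-monoʳ-≤ 2 cost≤))
    where
    lb : LowerBounds B
    lb = lower-bounds desc pos (subst (2 ≤_) (sym len) n≥2) (subst (_≤ 9) (sym len) n≤9)
    cost≤ : spCost B ≤ spCost A
    cost≤ = cost-mono {A} {B} (∈-resp-↭ B↭A)

posSet? : ∀ A → Dec (IsPosSet A)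
posSet? A = unique? A ×-dec All.all? (1 ≤?_) A

minimum₃ : ∀ A {_ : True (posSet? A)} → spCost A ≡ 3 * length A ∸ 3 → 2 ≤ length A → length A ≤ 9 →
           SPis (length A) (3 * length A ∸ 3)
minimum₃ A {pos-set} cost≡ n≥2 n≤9 = (A , toWitness pos-set , refl , cost≡) , λ B pos-set' len →
  m≤n+o⇒m∸n≤o (3 * length A) 3 (subst (λ n → 3 * n ≤ 3 + spCost B) len
    (proj₁ (cost-bounds B pos-set' (subst (2 ≤_) (sym len) n≥2) (subst (_≤ 9) (sym len) n≤9))))

minimum₂ : ∀ A {_ : True (posSet? A)} → spCost A ≡ 3 * length A ∸ 2 → 8 ≤ length A → length A ≤ 9 →
           SPis (length A) (3 * length A ∸ 2)
minimum₂ A {pos-set} cost≡ n≥8 n≤9 = (A , toWitness pos-set , refl , cost≡) , λ B pos-set' len →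
  m≤n+o⇒m∸n≤o (3 * length A) 2 (subst (λ n → 3 * n ≤ 2 + spCost B) len
    (proj₂ (cost-bounds B pos-set' (subst (2 ≤_) (sym len) (≤-trans (m≤m+n 2 6) n≥8)) (subst (_≤ 9) (sym len) n≤9))
      (subst (8 ≤_) (sym len) n≥8)))

theorem1p1 : ((k : ℕ) → 2 ≤ k → k ≤ 7 → SPis k (3 * k ∸ 3))
    × SPis 8 (3 * 8 ∸ 2) × SPis 9 (3 * 9 ∸ 2)
-- The witnesses are the first eight and the first nine numbers of the form `2 ^ a * 3 ^ b`.
theorem1p1 = small , minimum₂ (1 ∷ 2 ∷ 3 ∷ 4 ∷ 6 ∷ 8 ∷ 9 ∷ 12 ∷ []) refl ≤-refl (n≤1+n 8) ,
                     minimum₂ (1 ∷ 2 ∷ 3 ∷ 4 ∷ 6 ∷ 8 ∷ 9 ∷ 12 ∷ 16 ∷ []) refl (n≤1+n 8) ≤-refl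
  where
  small : (k : ℕ) → 2 ≤ k → k ≤ 7 → SPis k (3 * k ∸ 3)
  small 2 _ _ = minimum₃ (1 ∷ 2 ∷ []) refl (m≤m+n 2 0) (m≤m+n 2 7)
  small 3 _ _ = minimum₃ (1 ∷ 2 ∷ 3 ∷ []) refl (m≤m+n 2 1) (m≤m+n 3 6)
  small 4 _ _ = minimum₃ (1 ∷ 2 ∷ 3 ∷ 4 ∷ []) refl (m≤m+n 2 2) (m≤m+n 4 5)
  small 5 _ _ = minimum₃ (1 ∷ 2 ∷ 3 ∷ 4 ∷ 6 ∷ []) refl (m≤m+n 2 3) (m≤m+n 5 4)
  small 6 _ _ = minimum₃ (1 ∷ 2 ∷ 3 ∷ 4 ∷ 6 ∷ 8 ∷ []) refl (m≤m+n 2 4) (m≤m+n 6 3)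
  -- Leaving out 9 gives two progressions of ratio 2, namely `1, 2, 4, 8` and `3, 6, 12`, with
  -- `7 + 6 + 5 = 18` products.
  small 7 _ _ = minimum₃ (1 ∷ 2 ∷ 3 ∷ 4 ∷ 6 ∷ 8 ∷ 12 ∷ []) refl (m≤m+n 2 5) (m≤m+n 7 2)
  small 0 () _
  small 1 (s≤s ()) _
  small (suc (suc (suc (suc (suc (suc (suc (suc _)))))))) _ (s≤s (s≤s (s≤s (s≤s (s≤s (s≤s (s≤s ())))))))
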